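{- For $n\ge1$ and $t\in\mathfrak T_{2n+1}$ put $\mathrm{Eoc}(t)=\mathrm{eoc}(t)$ and $\mathrm{Pom}(t)=2n+1-\mathrm{pom}(t)$, and let $\mathfrak T_{2n+1}(x,y)=\sum_{t\in\mathfrak T_{2n+1}}x^{\mathrm{Eoc}(t)}y^{\mathrm{Pom}(t)}$. Then $\mathfrak T_{2n+1}(x,y)=\mathfrak T_{2n+1}(y,x)$.
   Context: A strictly ordered binary tree on $N$ vertices is a rooted tree whose vertices are labeled bijectively by $1,\dots,N$, the root being labeled $1$, in which every vertex has either no child (a leaf) or exactly two children (their order is immaterial), and labels increase along every path from the root. $\mathfrak T_{2n+1}$ denotes the set of these trees on $2n+1$ vertices. For $t\in\mathfrak T_{2n+1}$ ($n\ge1$): the minimal chain starts at the root and repeatedly moves to the child with the smaller label until a leaf is reached; $\mathrm{eoc}(t)$ is the label of that leaf. The vertex $2n+1$ is a leaf, and $\mathrm{pom}(t)$ is the label of its parent. -}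

module Defs where

open import Data.Nat using (ℕ; zero; suc; _+_; _*_; _∸_; _<ᵇ_; _≡ᵇ_)
open import Data.Bool using (Bool; true; false; _∧_; _∨_; if_then_else_; T)
open import Data.List using (List; []; _∷_; _++_; length; upTo; map)
open import Data.Maybe using (Maybe; just; nothing)
open import Data.Product using (Σ; _×_)
open import Relation.Binary.PropositionalEquality using (_≡_)

data Tree : Set where
  leaf : ℕ → Tree
  node : ℕ → Tree → Tree → Tree

root : Tree → ℕ
root (leaf l)     = l
root (node l _ _) = l

labels : Tree → List ℕ
labels (leaf l)     = l ∷ []
labels (node l a b) = l ∷ labels a ++ labels b

occ : ℕ → List ℕ → ℕ
occ k []       = 0
occ k (x ∷ xs) = if k ≡ᵇ x then suc (occ k xs) else occ k xs

-- labels increase along every edge (hence along every path from the root);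
-- since the order of the two children is immaterial, we fix the canonical
-- representative in which the left child has the smaller label.
increasing : Tree → Bool
increasing (leaf _)     = true
increasing (node l a b) =
  (l <ᵇ root a) ∧ (l <ᵇ root b) ∧ (root a <ᵇ root b) ∧ increasing a ∧ increasing b

allB : (ℕ → Bool) → List ℕ → Bool
allB p []       = true
allB p (x ∷ xs) = p x ∧ allB p xs

bijLabels : ℕ → Tree → Bool
bijLabels N t =
  (length (labels t) ≡ᵇ N) ∧ allB (λ k → occ (suc k) (labels t) ≡ᵇ 1) (upTo N)

isSOBT : ℕ → Tree → Bool
isSOBT N t = bijLabels N t ∧ (root t ≡ᵇ 1) ∧ increasing t

eoc : Tree → ℕ
eoc (leaf l)     = l
eoc (node l a b) = if root a <ᵇ root b then eoc a else eoc b

parentOf : ℕ → Tree → Maybe ℕ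
parentOf v (leaf _) = nothing
parentOf v (node l a b) with (root a ≡ᵇ v) ∨ (root b ≡ᵇ v)
... | true  = just l
... | false with parentOf v a
...   | just p  = just p
...   | nothing = parentOf v b

Eoc : Tree → ℕ
Eoc = eoc

Pom : ℕ → Tree → Maybe ℕ
Pom n t with parentOf (2 * n + 1) t
... | just p  = just (2 * n + 1 ∸ p)
... | nothing = nothing

-- The trees in 𝔗_{2n+1} with Eoc = a and Pom = b, i.e. the objects counted by
-- the coefficient of x^a y^b in 𝔗_{2n+1}(x,y).
TreesEP : ℕ → ℕ → ℕ → Set
TreesEP n a b = Σ Tree (λ t → T (isSOBT (2 * n + 1) t) × Eoc t ≡ a × Pom n t ≡ just b)

{-# OPTIONS --safe #-}
-- Build a tree by adding the labels N, N - 1, ..., 1 (N = 2n + 1) to a forest kept sorted by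
-- root: each label is either a new leaf or joins two of the present trees.  Both statistics can
-- be watched during this process: eoc t = a says that the tree containing the leaf a is never
-- joined with one of smaller root, and pom t = p says that N stays a tree of its own until it is
-- joined at the label p.  The number of completions of a forest depends only on its size and,
-- linearly, on the rank of the tree containing a, and every step acts by the operator
--   (L h) k = h (k + 1) + (k choose 2) h (k - 1).
-- With X the multiplication by k, the number of trees with eoc = a, Pom = b is, when a < p,
--   (L^(b-1) X L^m X α_(a-1)) 0,   α_t = L^(t-1) δ₁,
-- and, when a > p, a similar expression in a two-component version of L.  In the
-- bilinear form with weights 1 / G k, G k = ∏_{2 ≤ j ≤ k} (j choose 2), the operator L is
-- self-adjoint, so that reading the expression backwards exchanges a and b.
module Submission where

open import Defs
open import Axiom.UniquenessOfIdentityProofs using (module Decidable⇒UIP)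
open import Data.Bool using (Bool; true; false; T; _∧_; if_then_else_)
open import Data.Bool.Properties using (T-∧; T-irrelevant; T-≡)
open import Data.Empty using (⊥-elim)
open import Data.Fin as Fin using (cast)
open import Data.Fin.Properties using (cast-involutive)
open import Data.List using (List; []; _∷_; _++_; _∷ʳ_; length; map; concatMap; filter; lookup)
open import Data.List.Properties using (map-++; map-∘; ++-identityʳ; ++-assoc)
open import Data.List.Membership.Propositional using (_∈_; find; lose)
open import Data.List.Membership.Propositional.Properties using (∈-map⁺; ∈-map⁻; ∈-++⁺ˡ; ∈-++⁺ʳ; ∈-++⁻; ∈-concatMap⁺; ∈-concatMap⁻; ∈-∃++; ∈-lookup; ∈-upTo⁺; ∈-upTo⁻; ∈-filter⁺; ∈-filter⁻)
open import Data.List.Relation.Binary.Disjoint.Propositional using (Disjoint)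
import Data.List.Relation.Binary.Permutation.Propositional as Perm
open import Data.List.Relation.Binary.Permutation.Propositional using (_↭_; prep; swap; ↭-refl; ↭-reflexive; ↭-sym; ↭-trans; ↭⇒↭ₛ)
open import Data.List.Relation.Binary.Permutation.Propositional.Properties using (↭-length; All-resp-↭; Any-resp-↭; ∈-resp-↭; shift; shifts; ++⁺ˡ; drop-∷)
import Data.List.Relation.Binary.Permutation.Setoid.Properties as PermSetoid
open import Data.List.Relation.Unary.All as All using (All; []; _∷_)
open import Data.List.Relation.Unary.AllPairs using (AllPairs; []; _∷_)
open import Data.List.Relation.Unary.Any using (Any; here; there; index)
open import Data.List.Relation.Unary.Any.Properties using (lookup-index)
open import Data.List.Relation.Unary.Unique.Propositional using (Unique)
import Data.List.Relation.Unary.Unique.Propositional.Properties as Uniq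
open import Data.Maybe using (Maybe; just; nothing; _<∣>_)
open import Data.Maybe.Properties using (just-injective; ≡-dec)
open import Data.Nat using (ℕ; zero; suc; _+_; _*_; _∸_; _≤_; _<_; z≤n; s≤s; _≡ᵇ_; _<ᵇ_)
open import Data.Nat.GeneralisedArithmetic using (fold)
open import Data.Nat.ListAction using (sum)
open import Data.Nat.ListAction.Properties using (sum-++)
open import Data.Nat.Properties
open import Data.Nat.Tactic.RingSolver using (solve-∀)
open import Data.Product as Prod using (Σ; ∃; _×_; _,_; proj₁; proj₂; map₂)
open import Data.Sum using (_⊎_; inj₁; inj₂)
open import Function using (_∘_)
open import Function.Bundles using (_↔_; mk↔ₛ′; Equivalence)
open import Relation.Binary.Definitions using (tri<; tri≈; tri>)
open import Relation.Binary.PropositionalEquality using (_≡_; _≢_; refl; sym; trans; cong; cong₂; subst; setoid; module ≡-Reasoning)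
open import Relation.Nullary using (Dec; yes; no)
open import Relation.Nullary.Decidable using (_×-dec_; dec-true; dec-false)

-- The operator L and its self-adjointness

-- Linearity in the rank comes from an eigenvalue. Let `w` be the number of trees of larger root
-- than the marked one, and 0 if no tree is marked. Summed over all joins of two among k trees, the
-- new `w` is (k - 1 choose 2) times the old one, and a new unmarked leaf leaves `w` unchanged.
-- While N is still open this does not suffice, because the marked tree may itself be joined to N:
-- the indicator `W` of a mark enters, and the joins send `W` to `w` + (k - 1 choose 2) `W`. The
-- span of the two is preserved but not diagonal. This is the obstacle: `M` feeds the first
-- component into the second, `M*` feeds the second into the first, and scaling by `G` together with
-- exchanging the components does not turn one into the other. A multiple c of the first component
-- has to be added; the condition on it is (x + 1 choose 2) (c (x + 1) - c x) = 1, whence c x = γ -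
-- 2 / x, and the initial states give γ = 1.

tri : ℕ → ℕ
tri zero    = 0
tri (suc k) = k + tri k

2*tri : ∀ k → 2 * tri (suc k) ≡ suc k * k
2*tri zero    = refl
2*tri (suc k) = trans (eq₁ k (tri (suc k))) (trans (cong (λ z → 2 * suc k + z) (2*tri k)) (eq₂ k))
  where
  eq₁ : ∀ k t → 2 * (suc k + t) ≡ 2 * suc k + 2 * t
  eq₁ = solve-∀
  eq₂ : ∀ k → 2 * suc k + suc k * k ≡ suc (suc k) * suc k
  eq₂ = solve-∀

delay : (ℕ → ℕ) → ℕ → ℕ
delay h zero    = 0
delay h (suc k) = h k

-- L* is the transpose of L for the pairing ⟨_∣_⟩_ below; delay h 0 = 0 stands for h (-1).
X L L* : (ℕ → ℕ) → ℕ → ℕ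
X h k  = k * h k
L h k  = h (suc k) + tri k * delay h k
L* φ k = delay φ k + tri (suc k) * φ (suc k)

State : Set
State = (ℕ → ℕ) × (ℕ → ℕ)

-- A state holds the coefficients of `W` and of `w`. The term `delay u` records the joins of the
-- marked tree itself with one of the `w` trees of larger root.
M M* : State → State
M  (u , v) = L u , λ k → L v k + delay u k
M* (μ , ν) = (λ k → L* μ k + ν (suc k)) , L* ν

fold-comm : ∀ {A : Set} (z : A) (s : A → A) m → s (fold z s m) ≡ fold (s z) s m
fold-comm z s zero    = refl
fold-comm z s (suc m) = cong s (fold-comm z s m)

⟨_∣_⟩_ : (ℕ → ℕ) → (ℕ → ℕ) → ℕ → ℕ
⟨ h ∣ φ ⟩ zero    = 0
⟨ h ∣ φ ⟩ (suc K) = ⟨ h ∣ φ ⟩ K + h K * φ K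

-- Summation by parts: the shifts in `L` and `L*` match except at the cut, and one boundary term on
-- each side keeps the identity free of subtraction.
L-adjoint-boundary : ∀ h φ K →
  ⟨ L h ∣ φ ⟩ K + tri K * φ K * delay h K ≡ ⟨ h ∣ L* φ ⟩ K + delay φ K * h K
L-adjoint-boundary h φ zero    = refl
L-adjoint-boundary h φ (suc K) = begin
  ⟨ L h ∣ φ ⟩ K + (h (suc K) + tri K * delay h K) * φ K + tri (suc K) * φ (suc K) * h K
    ≡⟨ eq₁ (⟨ L h ∣ φ ⟩ K) (h (suc K)) (tri K) (delay h K) (φ K) (tri (suc K) * φ (suc K) * h K) ⟩
  (⟨ L h ∣ φ ⟩ K + tri K * φ K * delay h K) + (h (suc K) * φ K + tri (suc K) * φ (suc K) * h K)
    ≡⟨ cong (_+ (h (suc K) * φ K + tri (suc K) * φ (suc K) * h K)) (L-adjoint-boundary h φ K) ⟩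
  (⟨ h ∣ L* φ ⟩ K + delay φ K * h K) + (h (suc K) * φ K + tri (suc K) * φ (suc K) * h K)
    ≡⟨ eq₂ (⟨ h ∣ L* φ ⟩ K) (delay φ K) (h K) (h (suc K)) (φ K) (tri (suc K) * φ (suc K)) ⟩
  ⟨ h ∣ L* φ ⟩ K + h K * (delay φ K + tri (suc K) * φ (suc K)) + φ K * h (suc K) ∎
  where
  open ≡-Reasoning
  eq₁ : ∀ s a t b c d → s + (a + t * b) * c + d ≡ (s + t * c * b) + (a * c + d)
  eq₁ = solve-∀
  eq₂ : ∀ s p h h′ f t → (s + p * h) + (h′ * f + t * h) ≡ s + h * (p + t) + f * h′
  eq₂ = solve-∀

delay-adjoint-boundary : ∀ h φ K →
  ⟨ delay h ∣ φ ⟩ K + delay h K * φ K ≡ ⟨ h ∣ (λ x → φ (suc x)) ⟩ K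
delay-adjoint-boundary h φ zero    = refl
delay-adjoint-boundary h φ (suc K) = cong (_+ h K * φ (suc K)) (delay-adjoint-boundary h φ K)

⟨⟩-cong : ∀ {h h′ φ φ′} K → (∀ x → h x * φ x ≡ h′ x * φ′ x) → ⟨ h ∣ φ ⟩ K ≡ ⟨ h′ ∣ φ′ ⟩ K
⟨⟩-cong zero    eq = refl
⟨⟩-cong (suc K) eq = cong₂ _+_ (⟨⟩-cong K eq) (eq K)

⟨⟩-+ˡ : ∀ h h′ φ K → ⟨ (λ x → h x + h′ x) ∣ φ ⟩ K ≡ ⟨ h ∣ φ ⟩ K + ⟨ h′ ∣ φ ⟩ K
⟨⟩-+ˡ h h′ φ zero    = refl
⟨⟩-+ˡ h h′ φ (suc K) = trans (cong (_+ (h K + h′ K) * φ K) (⟨⟩-+ˡ h h′ φ K))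
  (eq (⟨ h ∣ φ ⟩ K) (⟨ h′ ∣ φ ⟩ K) (h K) (h′ K) (φ K))
  where
  eq : ∀ a b c d e → a + b + (c + d) * e ≡ (a + c * e) + (b + d * e)
  eq = solve-∀

⟨⟩-+ʳ : ∀ h φ φ′ K → ⟨ h ∣ (λ x → φ x + φ′ x) ⟩ K ≡ ⟨ h ∣ φ ⟩ K + ⟨ h ∣ φ′ ⟩ K
⟨⟩-+ʳ h φ φ′ zero    = refl
⟨⟩-+ʳ h φ φ′ (suc K) = trans (cong (_+ h K * (φ K + φ′ K)) (⟨⟩-+ʳ h φ φ′ K))
  (eq (⟨ h ∣ φ ⟩ K) (⟨ h ∣ φ′ ⟩ K) (h K) (φ K) (φ′ K))
  where
  eq : ∀ a b c d e → a + b + c * (d + e) ≡ (a + c * d) + (b + c * e)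
  eq = solve-∀

Supp : ℕ → (ℕ → ℕ) → Set
Supp n φ = ∀ x → n < x → φ x ≡ 0

Supp-L* : ∀ {n φ} → Supp n φ → Supp (suc n) (L* φ)
Supp-L* s (suc x) (s≤s n<x)
  rewrite s x n<x | s (suc (suc x)) (m<n⇒m<1+n (m<n⇒m<1+n n<x)) = *-zeroʳ (tri (suc (suc x)))

Supp-X : ∀ {n φ} → Supp n φ → Supp n (X φ)
Supp-X s x n<x rewrite s x n<x = *-zeroʳ x

Supp-M* : ∀ {n Φ} → Supp n (proj₁ Φ) → Supp n (proj₂ Φ) →
  Supp (suc n) (proj₁ (M* Φ)) × Supp (suc n) (proj₂ (M* Φ))
Supp-M* s t = (λ { x n<x → cong₂ _+_ (Supp-L* s x n<x) (t (suc x) (m<n⇒m<1+n (<-trans (n<1+n _) n<x))) })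
            , Supp-L* t

L-adjoint : ∀ h {φ n} K → Supp n φ → n < K → ⟨ L h ∣ φ ⟩ suc K ≡ ⟨ h ∣ L* φ ⟩ suc K
L-adjoint h {φ} K s n<K = begin
  ⟨ L h ∣ φ ⟩ suc K
    ≡⟨ +-identityʳ _ ⟨
  ⟨ L h ∣ φ ⟩ suc K + 0
    ≡⟨ cong (λ z → ⟨ L h ∣ φ ⟩ suc K + z * h K)
         (trans (cong (tri (suc K) *_) (s (suc K) (m<n⇒m<1+n n<K))) (*-zeroʳ (tri (suc K)))) ⟨
  ⟨ L h ∣ φ ⟩ suc K + tri (suc K) * φ (suc K) * h K
    ≡⟨ L-adjoint-boundary h φ (suc K) ⟩
  ⟨ h ∣ L* φ ⟩ suc K + φ K * h (suc K)
    ≡⟨ cong (λ z → ⟨ h ∣ L* φ ⟩ suc K + z * h (suc K)) (s K n<K) ⟩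
  ⟨ h ∣ L* φ ⟩ suc K + 0
    ≡⟨ +-identityʳ _ ⟩
  ⟨ h ∣ L* φ ⟩ suc K ∎
  where open ≡-Reasoning

delay-adjoint : ∀ h {φ n} K → Supp n φ → n < K →
  ⟨ delay h ∣ φ ⟩ suc K ≡ ⟨ h ∣ (λ x → φ (suc x)) ⟩ suc K
delay-adjoint h {φ} K s n<K = begin
  ⟨ delay h ∣ φ ⟩ suc K
    ≡⟨ +-identityʳ _ ⟨
  ⟨ delay h ∣ φ ⟩ suc K + 0
    ≡⟨ cong (⟨ delay h ∣ φ ⟩ suc K +_)
         (trans (cong (h K *_) (s (suc K) (m<n⇒m<1+n n<K))) (*-zeroʳ (h K))) ⟨
  ⟨ delay h ∣ φ ⟩ suc K + h K * φ (suc K)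
    ≡⟨ delay-adjoint-boundary h φ (suc K) ⟩
  ⟨ h ∣ (λ x → φ (suc x)) ⟩ suc K ∎
  where open ≡-Reasoning

⟪_∣_⟫_ : State → State → ℕ → ℕ
⟪ (u , v) ∣ (μ , ν) ⟫ K = ⟨ u ∣ μ ⟩ K + ⟨ v ∣ ν ⟩ K

M-adjoint : ∀ T {Φ n} K → Supp n (proj₁ Φ) → Supp n (proj₂ Φ) → n < K →
  ⟪ M T ∣ Φ ⟫ suc K ≡ ⟪ T ∣ M* Φ ⟫ suc K
M-adjoint (u , v) {μ , ν} K s t n<K = begin
  ⟨ L u ∣ μ ⟩ suc K + ⟨ (λ k → L v k + delay u k) ∣ ν ⟩ suc K
    ≡⟨ cong₂ _+_ (L-adjoint u K s n<K) (⟨⟩-+ˡ (L v) (delay u) ν (suc K)) ⟩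
  ⟨ u ∣ L* μ ⟩ suc K + (⟨ L v ∣ ν ⟩ suc K + ⟨ delay u ∣ ν ⟩ suc K)
    ≡⟨ cong (⟨ u ∣ L* μ ⟩ suc K +_) (cong₂ _+_ (L-adjoint v K t n<K) (delay-adjoint u K t n<K)) ⟩
  ⟨ u ∣ L* μ ⟩ suc K + (⟨ v ∣ L* ν ⟩ suc K + ⟨ u ∣ (λ x → ν (suc x)) ⟩ suc K)
    ≡⟨ eq (⟨ u ∣ L* μ ⟩ suc K) (⟨ v ∣ L* ν ⟩ suc K) (⟨ u ∣ (λ x → ν (suc x)) ⟩ suc K) ⟩
  ⟨ u ∣ L* μ ⟩ suc K + ⟨ u ∣ (λ x → ν (suc x)) ⟩ suc K + ⟨ v ∣ L* ν ⟩ suc K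
    ≡⟨ cong (_+ ⟨ v ∣ L* ν ⟩ suc K) (⟨⟩-+ʳ u (L* μ) (λ x → ν (suc x)) (suc K)) ⟨
  ⟨ u ∣ (λ k → L* μ k + ν (suc k)) ⟩ suc K + ⟨ v ∣ L* ν ⟩ suc K ∎
  where
  open ≡-Reasoning
  eq : ∀ a b c → a + (b + c) ≡ a + c + b
  eq = solve-∀

-- Finite support of the second argument alone kills the boundary terms. Each `L*` widens the
-- support by one, so m transpositions are exact once the cut exceeds m + n.
L-adjointⁿ : ∀ m h {φ n} K → Supp n φ → m + n < K →
  ⟨ fold h L m ∣ φ ⟩ suc K ≡ ⟨ h ∣ fold φ L* m ⟩ suc K
L-adjointⁿ zero    h K s m+n<K = refl
L-adjointⁿ (suc m) h {φ} {n} K s m+n<K = begin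
  ⟨ L (fold h L m) ∣ φ ⟩ suc K
    ≡⟨ L-adjoint (fold h L m) K s (≤-<-trans (m≤n+m n (suc m)) m+n<K) ⟩
  ⟨ fold h L m ∣ L* φ ⟩ suc K
    ≡⟨ L-adjointⁿ m h K (Supp-L* s) (subst (_< K) (sym (+-suc m n)) m+n<K) ⟩
  ⟨ h ∣ fold (L* φ) L* m ⟩ suc K
    ≡⟨ cong (λ z → ⟨ h ∣ z ⟩ suc K) (fold-comm φ L* m) ⟨
  ⟨ h ∣ L* (fold φ L* m) ⟩ suc K ∎
  where open ≡-Reasoning

M-adjointⁿ : ∀ m T {Φ n} K → Supp n (proj₁ Φ) → Supp n (proj₂ Φ) → m + n < K →
  ⟪ fold T M m ∣ Φ ⟫ suc K ≡ ⟪ T ∣ fold Φ M* m ⟫ suc K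
M-adjointⁿ zero    T K s t m+n<K = refl
M-adjointⁿ (suc m) T {Φ} {n} K s t m+n<K = begin
  ⟪ M (fold T M m) ∣ Φ ⟫ suc K
    ≡⟨ M-adjoint (fold T M m) K s t (≤-<-trans (m≤n+m n (suc m)) m+n<K) ⟩
  ⟪ fold T M m ∣ M* Φ ⟫ suc K
    ≡⟨ M-adjointⁿ m T K (proj₁ (Supp-M* s t)) (proj₂ (Supp-M* s t)) (subst (_< K) (sym (+-suc m n)) m+n<K) ⟩
  ⟪ T ∣ fold (M* Φ) M* m ⟫ suc K
    ≡⟨ cong (λ z → ⟪ T ∣ z ⟫ suc K) (fold-comm Φ M* m) ⟨
  ⟪ T ∣ M* (fold Φ M* m) ⟫ suc K ∎
  where open ≡-Reasoning

-- If h = G φ then L h = G (L* φ).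
G : ℕ → ℕ
G zero          = 1
G (suc zero)    = 1
G (suc (suc x)) = G (suc x) * tri (suc (suc x))

-- The relation h = G φ is asked at positive arguments only: since `tri 1` is 0, `L* φ` vanishes at
-- 0, while `L h 0` is `h 1`. With `φ 0 ≡ 0` the pairing does not see the values at 0.
record Rel₁ (h φ : ℕ → ℕ) : Set where
  field
    φ0 : φ 0 ≡ 0
    hφ : ∀ x → h (suc x) ≡ G (suc x) * φ (suc x)
open Rel₁

-- Detailed balance: `G (x + 1)` is `G x * tri (x + 1)` for x ≥ 1.
Rel₁-L : ∀ {h φ} → Rel₁ h φ → Rel₁ (L h) (L* φ)
Rel₁-L r .φ0 = refl
Rel₁-L {h} {φ} r .hφ zero rewrite hφ r 1 | φ0 r = eq (φ 2)
  where
  eq : ∀ a → 1 * a + 0 ≡ 1 * (0 + 1 * a)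
  eq = solve-∀
Rel₁-L {h} {φ} r .hφ (suc x) rewrite hφ r (suc (suc x)) | hφ r x =
  eq (G (suc x)) (tri (suc (suc x))) (tri (suc (suc (suc x)))) (φ (suc (suc (suc x)))) (φ (suc x))
  where
  eq : ∀ g s t a b → g * s * t * a + s * (g * b) ≡ g * s * (b + t * a)
  eq = solve-∀

Rel₁-X : ∀ {h φ} → (∀ x → h (suc x) ≡ G (suc x) * φ (suc x)) → Rel₁ (X h) (X φ)
Rel₁-X r .φ0 = refl
Rel₁-X {h} {φ} r .hφ x rewrite r x = eq (suc x) (G (suc x)) (φ (suc x))
  where
  eq : ∀ x g a → x * (g * a) ≡ g * (x * a)
  eq = solve-∀

Rel₁-fold : ∀ {h φ} m → Rel₁ h φ → Rel₁ (fold h L m) (fold φ L* m)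
Rel₁-fold zero    r = r
Rel₁-fold (suc m) r = Rel₁-L (Rel₁-fold m r)

-- At positive arguments both integrands are G φ φ′; at 0 both vanish.
Rel₁-swap : ∀ {h φ h′ φ′} K → Rel₁ h φ → Rel₁ h′ φ′ → ⟨ h ∣ φ′ ⟩ K ≡ ⟨ h′ ∣ φ ⟩ K
Rel₁-swap {h} {φ} {h′} {φ′} K r r′ = ⟨⟩-cong K pointwise
  where
  eq : ∀ g a b → g * a * b ≡ g * b * a
  eq = solve-∀
  pointwise : ∀ x → h x * φ′ x ≡ h′ x * φ x
  pointwise zero rewrite φ0 r | φ0 r′ = trans (*-zeroʳ (h 0)) (sym (*-zeroʳ (h′ 0)))
  pointwise (suc x) rewrite hφ r x | hφ r′ x = eq (G (suc x)) (φ (suc x)) (φ′ (suc x))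

-- vμ is v = G μ + (1 - 2 / x) u, cleared of the denominator and of the subtraction.
record Rel₂ (T Φ : State) : Set where
  field
    uν : Rel₁ (proj₁ T) (proj₂ Φ)
    uμ0 : proj₁ T 0 ≡ proj₁ Φ 0
    vμ : ∀ x → suc x * proj₂ T (suc x) + 2 * proj₁ T (suc x)
             ≡ suc x * (G (suc x) * proj₁ Φ (suc x) + proj₁ T (suc x))
open Rel₂

-- The correction c x = 1 - 2 / x works through its increments, tri (x + 1) (c (x + 1) - c x) = 1.
-- In the new second component at x, this increment turns the surplus of u (x + 1) into the term G x
-- ν (x + 1) coming from `M*` (this is `up`), and the preceding increment absorbs `delay u` (this is
-- `down`).
Rel₂-M : ∀ {T Φ} → Rel₂ T Φ → Rel₂ (M T) (M* Φ)
Rel₂-M r .uν = Rel₁-L (uν r)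
Rel₂-M {u , v} {μ , ν} r .uμ0 rewrite hφ (uν r) 0 = eq (ν 1)
  where
  eq : ∀ a → 1 * a + 0 ≡ a
  eq = solve-∀
-- The argument 1 is separate: its lower neighbour is 0, where only `uμ0` is available; at the upper
-- one, c 2 = 0 and G 2 = 1 give `v 2 ≡ μ 2`.
Rel₂-M {u , v} {μ , ν} r .vμ zero = begin
  1 * (v 2 + 0 + u 0) + 2 * (u 2 + 0)
    ≡⟨ cong₂ (λ y z → 1 * (v 2 + 0 + y) + (u 2 + 0 + z)) (uμ0 r) (trans (eq₀ (u 2)) (hφ (uν r) 1)) ⟩
  1 * (v 2 + 0 + μ 0) + (u 2 + 0 + 1 * ν 2)
    ≡⟨ cong (λ z → 1 * (z + 0 + μ 0) + (u 2 + 0 + 1 * ν 2)) v2 ⟩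
  1 * (μ 2 + 0 + μ 0) + (u 2 + 0 + 1 * ν 2)
    ≡⟨ eq₂ (μ 2) (μ 0) (u 2) (ν 2) ⟩
  1 * (1 * (μ 0 + 1 * μ 2 + ν 2) + (u 2 + 0)) ∎
  where
  open ≡-Reasoning
  eq₀ : ∀ a → a + 0 + 0 ≡ a
  eq₀ = solve-∀
  eq₁ : ∀ a b → 2 * (1 * a + b) ≡ 2 * a + 2 * b
  eq₁ = solve-∀
  eq₂ : ∀ a b c d → 1 * (a + 0 + b) + (c + 0 + 1 * d) ≡ 1 * (1 * (b + 1 * a + d) + (c + 0))
  eq₂ = solve-∀
  v2 : v 2 ≡ μ 2
  v2 = *-cancelˡ-≡ _ _ 2 (+-cancelʳ-≡ (2 * u 2) _ _ (trans (vμ r 1) (eq₁ (μ 2) (u 2))))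
Rel₂-M {u , v} {μ , ν} r .vμ (suc y) = begin
  x * (v z + t * v w + u w) + 2 * (u z + t * u w)
    ≡⟨ eq₁ x (v z) t (v w) (u w) (u z) ⟩
  (x * v z + 2 * u z) + (x * t * v w + x * u w + 2 * t * u w)
    ≡⟨ cong₂ _+_ up down ⟩
  x * (G z * μ z + u z + G x * ν z) + x * t * (G w * μ w + u w)
    ≡⟨ eq₂ x (G w) t (tri z) (μ z) (u z) (ν z) (μ w) (u w) ⟩
  x * (G x * (μ w + tri z * μ z + ν z) + (u z + t * u w)) ∎
  where
  open ≡-Reasoning
  w x z t : ℕ
  w = suc y
  x = suc w
  z = suc x
  t = tri x
  eq₁ : ∀ x vz t vw uw uz →
    x * (vz + t * vw + uw) + 2 * (uz + t * uw) ≡ (x * vz + 2 * uz) + (x * t * vw + x * uw + 2 * t * uw)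
  eq₁ = solve-∀
  eq₂ : ∀ x g t s mz uz nz mw uw →
    x * (g * t * s * mz + uz + g * t * nz) + x * t * (g * mw + uw)
    ≡ x * (g * t * (mw + s * mz + nz) + (uz + t * uw))
  eq₂ = solve-∀
  -- The hypothesis has denominator z, the goal denominator x; the factor z clears the former, and 2
  -- tri z = z x accounts for the difference of the two fractions.
  up : x * v z + 2 * u z ≡ x * (G z * μ z + u z + G x * ν z)
  up = *-cancelˡ-≡ _ _ z (begin
    z * (x * v z + 2 * u z)
      ≡⟨ e₁ x (v z) (u z) ⟩
    x * (z * v z + 2 * u z) + 2 * u z
      ≡⟨ cong₂ (λ p q → x * p + 2 * q) (vμ r x) (hφ (uν r) x) ⟩
    x * (z * (G z * μ z + u z)) + 2 * (G x * tri z * ν z)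
      ≡⟨ e₂ x z (G z * μ z + u z) (G x) (tri z) (ν z) ⟩
    x * (z * (G z * μ z + u z)) + 2 * tri z * (G x * ν z)
      ≡⟨ cong (λ p → x * (z * (G z * μ z + u z)) + p * (G x * ν z)) (2*tri x) ⟩
    x * (z * (G z * μ z + u z)) + z * x * (G x * ν z)
      ≡⟨ e₃ x z (G z * μ z + u z) (G x * ν z) ⟩
    z * (x * (G z * μ z + u z + G x * ν z)) ∎)
    where
    e₁ : ∀ x a b → suc x * (x * a + 2 * b) ≡ x * (suc x * a + 2 * b) + 2 * b
    e₁ = solve-∀
    e₂ : ∀ x z a g t n → x * (z * a) + 2 * (g * t * n) ≡ x * (z * a) + 2 * t * (g * n)
    e₂ = solve-∀
    e₃ : ∀ x z a b → x * (z * a) + z * x * b ≡ z * (x * (a + b))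
    e₃ = solve-∀
  down : x * t * v w + x * u w + 2 * t * u w ≡ x * t * (G w * μ w + u w)
  down = *-cancelˡ-≡ _ _ 2 (begin
    2 * (x * t * v w + x * u w + 2 * t * u w)
      ≡⟨ e₁ x t (v w) (u w) ⟩
    x * (2 * t) * v w + 2 * x * u w + 2 * (2 * t) * u w
      ≡⟨ cong (λ p → x * p * v w + 2 * x * u w + 2 * p * u w) (2*tri w) ⟩
    x * (x * w) * v w + 2 * x * u w + 2 * (x * w) * u w
      ≡⟨ e₂ w (v w) (u w) ⟩
    x * x * (w * v w + 2 * u w)
      ≡⟨ cong (x * x *_) (vμ r y) ⟩
    x * x * (w * (G w * μ w + u w))
      ≡⟨ e₃ x w (G w * μ w + u w) ⟩
    x * (x * w) * (G w * μ w + u w)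
      ≡⟨ cong (λ p → x * p * (G w * μ w + u w)) (2*tri w) ⟨
    x * (2 * t) * (G w * μ w + u w)
      ≡⟨ e₄ x t (G w * μ w + u w) ⟩
    2 * (x * t * (G w * μ w + u w)) ∎)
    where
    e₁ : ∀ x t a b → 2 * (x * t * a + x * b + 2 * t * b) ≡ x * (2 * t) * a + 2 * x * b + 2 * (2 * t) * b
    e₁ = solve-∀
    e₂ : ∀ w a b → suc w * (suc w * w) * a + 2 * suc w * b + 2 * (suc w * w) * b ≡ suc w * suc w * (w * a + 2 * b)
    e₂ = solve-∀
    e₃ : ∀ x w a → x * x * (w * a) ≡ x * (x * w) * a
    e₃ = solve-∀
    e₄ : ∀ x t a → x * (2 * t) * a ≡ 2 * (x * t * a)
    e₄ = solve-∀

Rel₂-fold : ∀ {T Φ} m → Rel₂ T Φ → Rel₂ (fold T M m) (fold Φ M* m)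
Rel₂-fold zero    r = r
Rel₂-fold (suc m) r = Rel₂-M (Rel₂-fold m r)

-- At a positive argument u μ′ + v ν′ = G (ν μ′ + ν′ μ) + c G ν ν′, which is symmetric in the two
-- pairs. `expand` is this identity cleared of the denominator and of the subtraction.
Rel₂-swap : ∀ {T Φ T′ Φ′} K → Rel₂ T Φ → Rel₂ T′ Φ′ → ⟪ T ∣ Φ′ ⟫ K ≡ ⟪ T′ ∣ Φ ⟫ K
Rel₂-swap zero r r′ = refl
Rel₂-swap {u , v} {μ , ν} {u′ , v′} {μ′ , ν′} (suc K) r r′ = begin
  ⟨ u ∣ μ′ ⟩ K + u K * μ′ K + (⟨ v ∣ ν′ ⟩ K + v K * ν′ K)
    ≡⟨ eq (⟨ u ∣ μ′ ⟩ K) (u K * μ′ K) (⟨ v ∣ ν′ ⟩ K) (v K * ν′ K) ⟩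
  ⟪ (u , v) ∣ (μ′ , ν′) ⟫ K + (u K * μ′ K + v K * ν′ K)
    ≡⟨ cong₂ _+_ (Rel₂-swap K r r′) (pointwise K) ⟩
  ⟪ (u′ , v′) ∣ (μ , ν) ⟫ K + (u′ K * μ K + v′ K * ν K)
    ≡⟨ eq (⟨ u′ ∣ μ ⟩ K) (u′ K * μ K) (⟨ v′ ∣ ν ⟩ K) (v′ K * ν K) ⟨
  ⟨ u′ ∣ μ ⟩ K + u′ K * μ K + (⟨ v′ ∣ ν ⟩ K + v′ K * ν K) ∎
  where
  open ≡-Reasoning
  eq : ∀ a b c d → a + b + (c + d) ≡ a + c + (b + d)
  eq = solve-∀
  expand : ∀ {u v μ ν u′ v′ μ′ ν′} → Rel₂ (u , v) (μ , ν) → Rel₂ (u′ , v′) (μ′ , ν′) → ∀ x →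
    suc x * (u (suc x) * μ′ (suc x) + v (suc x) * ν′ (suc x)) + 2 * (G (suc x) * ν (suc x) * ν′ (suc x))
    ≡ suc x * G (suc x) * (ν (suc x) * μ′ (suc x) + ν′ (suc x) * μ (suc x) + ν (suc x) * ν′ (suc x))
  expand {u} {v} {μ} {ν} {u′} {v′} {μ′} {ν′} r r′ y = begin
    x * (u x * μ′ x + v x * ν′ x) + 2 * (g * ν x * ν′ x)
      ≡⟨ cong (λ p → x * (p * μ′ x + v x * ν′ x) + 2 * (g * ν x * ν′ x)) (hφ (uν r) y) ⟩
    x * (g * ν x * μ′ x + v x * ν′ x) + 2 * (g * ν x * ν′ x)
      ≡⟨ e₁ x g (ν x) (μ′ x) (v x) (ν′ x) ⟩
    x * (g * ν x * μ′ x) + (x * v x + 2 * (g * ν x)) * ν′ x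
      ≡⟨ cong (λ p → x * (g * ν x * μ′ x) + (x * v x + 2 * p) * ν′ x) (hφ (uν r) y) ⟨
    x * (g * ν x * μ′ x) + (x * v x + 2 * u x) * ν′ x
      ≡⟨ cong (λ p → x * (g * ν x * μ′ x) + p * ν′ x) (vμ r y) ⟩
    x * (g * ν x * μ′ x) + (x * (g * μ x + u x)) * ν′ x
      ≡⟨ cong (λ p → x * (g * ν x * μ′ x) + (x * (g * μ x + p)) * ν′ x) (hφ (uν r) y) ⟩
    x * (g * ν x * μ′ x) + (x * (g * μ x + g * ν x)) * ν′ x
      ≡⟨ e₂ x g (ν x) (μ′ x) (μ x) (ν′ x) ⟩
    x * g * (ν x * μ′ x + ν′ x * μ x + ν x * ν′ x) ∎
    where
    x g : ℕ
    x = suc y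
    g = G x
    e₁ : ∀ x g n m v n′ → x * (g * n * m + v * n′) + 2 * (g * n * n′) ≡ x * (g * n * m) + (x * v + 2 * (g * n)) * n′
    e₁ = solve-∀
    e₂ : ∀ x g n m′ m n′ → x * (g * n * m′) + (x * (g * m + g * n)) * n′ ≡ x * g * (n * m′ + n′ * m + n * n′)
    e₂ = solve-∀
  flip₁ : ∀ x g a b c d → x * g * (a * b + c * d + a * c) ≡ x * g * (c * d + a * b + c * a)
  flip₁ = solve-∀
  flip₂ : ∀ g a b → 2 * (g * a * b) ≡ 2 * (g * b * a)
  flip₂ = solve-∀
  pointwise : ∀ x → u x * μ′ x + v x * ν′ x ≡ u′ x * μ x + v′ x * ν x
  pointwise zero rewrite φ0 (uν r) | φ0 (uν r′) | uμ0 r | uμ0 r′ =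
    cong₂ _+_ (*-comm (μ 0) (μ′ 0)) (trans (*-zeroʳ (v 0)) (sym (*-zeroʳ (v′ 0))))
  pointwise (suc y) = *-cancelˡ-≡ _ _ (suc y) (+-cancelʳ-≡ (2 * (G x * ν x * ν′ x)) _ _ (begin
    x * (u x * μ′ x + v x * ν′ x) + 2 * (G x * ν x * ν′ x)
      ≡⟨ expand r r′ y ⟩
    x * G x * (ν x * μ′ x + ν′ x * μ x + ν x * ν′ x)
      ≡⟨ flip₁ x (G x) (ν x) (μ′ x) (ν′ x) (μ x) ⟩
    x * G x * (ν′ x * μ x + ν x * μ′ x + ν′ x * ν x)
      ≡⟨ expand r′ r y ⟨
    x * (u′ x * μ x + v′ x * ν x) + 2 * (G x * ν′ x * ν x)
      ≡⟨ cong (x * (u′ x * μ x + v′ x * ν x) +_) (flip₂ (G x) (ν′ x) (ν x)) ⟩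
    x * (u′ x * μ x + v′ x * ν x) + 2 * (G x * ν x * ν′ x) ∎))
    where
    x : ℕ
    x = suc y

-- The counting sequences and the symmetry of the counts

δ₀ δ₁ : ℕ → ℕ
δ₀ zero    = 1
δ₀ (suc _) = 0
δ₁ = delay δ₀

-- `φ t` represents the functional h ↦ (L^t h) 0, by which a count is read off at the empty forest.
-- `α 0` is chosen to agree with `φ 0`; then `X (α 0)` is 0, as it must be, since the root of a tree
-- with several vertices is no leaf.
α φ : ℕ → ℕ → ℕ
α zero    = δ₀
α (suc t) = fold δ₁ L t
φ t = fold δ₀ L* t

-- The seeds agree because L* δ₀ = δ₁ and G 1 = 1. Index 0 is excluded because δ₀ does not vanish at
-- 0.
αφ : ∀ t → Rel₁ (α (suc t)) (φ (suc t))
αφ zero .φ0 = refl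
αφ zero .hφ zero    = refl
αφ zero .hφ (suc x) = sym (trans (cong (G (suc (suc x)) *_) (*-zeroʳ (tri (suc (suc (suc x)))))) (*-zeroʳ (G (suc (suc x)))))
αφ (suc t) = Rel₁-L (αφ t)

αφ-suc : ∀ t x → α t (suc x) ≡ G (suc x) * φ t (suc x)
αφ-suc zero    x = sym (*-zeroʳ (G (suc x)))
αφ-suc (suc t) x = hφ (αφ t) x

Supp-φ : ∀ t → Supp t (φ t)
Supp-φ zero    (suc x) _ = refl
Supp-φ (suc t) = Supp-L* (Supp-φ t)

-- The coefficients counting completions when the next label is t + 1 and has to join N.
T₀ : ℕ → State
T₀ zero    = δ₀ , λ _ → 0
T₀ (suc t) = X (α (suc t)) , λ x → (x ∸ 1) * α (suc t) x

-- This fixes the additive constant in c: with u = x α, v = (x - 1) α and G μ = α, the equation v =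
-- G μ + c u reads c = 1 - 2 / x. For t = 0 everything sits at the argument 0, where `uμ0` compares
-- 1 with 1.
Rel-T₀ : ∀ t → Rel₂ (T₀ t) (φ t , X (φ t))
Rel-T₀ zero .uν .φ0 = refl
Rel-T₀ zero .uν .hφ x = sym (trans (cong (G (suc x) *_) (*-zeroʳ (suc x))) (*-zeroʳ (G (suc x))))
Rel-T₀ zero .uμ0 = refl
Rel-T₀ zero .vμ x = eq (suc x) (G (suc x))
  where
  eq : ∀ x g → x * 0 + 2 * 0 ≡ x * (g * 0 + 0)
  eq = solve-∀
Rel-T₀ (suc t) .uν = Rel₁-X (αφ-suc (suc t))
Rel-T₀ (suc t) .uμ0 = sym (φ0 (αφ t))
Rel-T₀ (suc t) .vμ x rewrite sym (αφ-suc (suc t) x) = eq x (α (suc t) (suc x))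
  where
  eq : ∀ x h → suc x * (x * h) + 2 * (suc x * h) ≡ suc x * (h + suc x * h)
  eq = solve-∀

⟨⟩-δ₀ : ∀ h K → ⟨ h ∣ δ₀ ⟩ suc K ≡ h 0
⟨⟩-δ₀ h zero    = *-identityʳ (h 0)
⟨⟩-δ₀ h (suc K) = trans (cong₂ _+_ (⟨⟩-δ₀ h K) (*-zeroʳ (h (suc K)))) (+-identityʳ (h 0))

fold-L-0 : ∀ s h K → s < K → fold h L s 0 ≡ ⟨ h ∣ φ s ⟩ suc K
fold-L-0 s h K s<K = trans (sym (⟨⟩-δ₀ (fold h L s) K))
  (L-adjointⁿ s h K (Supp-φ 0) (subst (_< K) (sym (+-identityʳ s)) s<K))

X-adjoint : ∀ h φ K → ⟨ X h ∣ φ ⟩ K ≡ ⟨ h ∣ X φ ⟩ K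
X-adjoint h φ K = ⟨⟩-cong K (λ x → eq x (h x) (φ x))
  where
  eq : ∀ x a b → x * a * b ≡ a * (x * b)
  eq = solve-∀

-- With t + 1 the smaller and t + m + 2 the larger of eoc and pom, and N = s + t + m + 3:
-- the number of trees with eoc < pom, and with eoc > pom.
count< count> : ℕ → ℕ → ℕ → ℕ
count< s m t = fold (X (fold (X (α t)) L m)) L s 0
count> s m t = fold (λ x → proj₁ (fold (T₀ t) M m) x + X (proj₂ (fold (T₀ t) M m)) x) L s 0

count<-sym : ∀ s m t → count< s m t ≡ count< t m s
count<-sym s m t = begin
  fold (X (fold (X (α t)) L m)) L s 0
    ≡⟨ as-pairing s t (m≤m+n (suc s) (m + t)) ⟩
  ⟨ fold (X (α t)) L m ∣ X (φ s) ⟩ suc K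
    ≡⟨ Rel₁-swap (suc K) (Rel₁-fold m (Rel₁-X (αφ-suc t))) (Rel₁-X (αφ-suc s)) ⟩
  ⟨ X (α s) ∣ fold (X (φ t)) L* m ⟩ suc K
    ≡⟨ L-adjointⁿ m (X (α s)) K (Supp-X (Supp-φ t)) (s≤s (m≤n+m (m + t) s)) ⟨
  ⟨ fold (X (α s)) L m ∣ X (φ t) ⟩ suc K
    ≡⟨ as-pairing t s (s≤s (≤-trans (m≤n+m t m) (m≤n+m (m + t) s))) ⟨
  fold (X (fold (X (α s)) L m)) L t 0 ∎
  where
  open ≡-Reasoning
  -- One cut for all steps: it exceeds s, t and the width m + t that `φ t` reaches under m
  -- applications of `L*`.
  K : ℕ
  K = suc (s + (m + t))
  as-pairing : ∀ s t → s < K → count< s m t ≡ ⟨ fold (X (α t)) L m ∣ X (φ s) ⟩ suc K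
  as-pairing s t s<K = trans (fold-L-0 s _ K s<K) (X-adjoint (fold (X (α t)) L m) (φ s) (suc K))

count>-sym : ∀ s m t → count> s m t ≡ count> t m s
count>-sym s m t = begin
  count> s m t
    ≡⟨ as-pairing s t (m≤m+n (suc s) (m + t)) ⟩
  ⟪ fold (T₀ t) M m ∣ (φ s , X (φ s)) ⟫ suc K
    ≡⟨ Rel₂-swap (suc K) (Rel₂-fold m (Rel-T₀ t)) (Rel-T₀ s) ⟩
  ⟪ T₀ s ∣ fold (φ t , X (φ t)) M* m ⟫ suc K
    ≡⟨ M-adjointⁿ m (T₀ s) K (Supp-φ t) (Supp-X (Supp-φ t)) (s≤s (m≤n+m (m + t) s)) ⟨
  ⟪ fold (T₀ s) M m ∣ (φ t , X (φ t)) ⟫ suc K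
    ≡⟨ as-pairing t s (s≤s (≤-trans (m≤n+m t m) (m≤n+m (m + t) s))) ⟨
  count> t m s ∎
  where
  open ≡-Reasoning
  K : ℕ
  K = suc (s + (m + t))
  as-pairing : ∀ s t → s < K → count> s m t ≡ ⟪ fold (T₀ t) M m ∣ (φ s , X (φ s)) ⟫ suc K
  as-pairing s t s<K = let (u , v) = fold (T₀ t) M m in begin
    fold (λ x → u x + X v x) L s 0
      ≡⟨ fold-L-0 s _ K s<K ⟩
    ⟨ (λ x → u x + X v x) ∣ φ s ⟩ suc K
      ≡⟨ ⟨⟩-+ˡ u (X v) (φ s) (suc K) ⟩
    ⟨ u ∣ φ s ⟩ suc K + ⟨ X v ∣ φ s ⟩ suc K
      ≡⟨ cong (⟨ u ∣ φ s ⟩ suc K +_) (X-adjoint v (φ s) (suc K)) ⟩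
    ⟨ u ∣ φ s ⟩ suc K + ⟨ v ∣ X (φ s) ⟩ suc K ∎

-- Weighted sums over pairs of a list

module _ {A : Set} where

  -- Sums over the ways of removing one element, or two elements in list order, from a list.
  selSum : List A → (A → List A → ℕ) → ℕ
  selSum []       f = 0
  selSum (x ∷ xs) f = f x xs + selSum xs (λ y R → f y (x ∷ R))

  pairSum : List A → (A → A → List A → ℕ) → ℕ
  pairSum []       f = 0
  pairSum (x ∷ xs) f = selSum xs (f x) + pairSum xs (λ y z R → f y z (x ∷ R))

  selSum-cong : ∀ xs {f g} → (∀ x R → x ∷ R ↭ xs → f x R ≡ g x R) → selSum xs f ≡ selSum xs g
  selSum-cong []       eq = refl
  selSum-cong (x ∷ xs) eq = cong₂ _+_ (eq x xs ↭-refl)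
    (selSum-cong xs (λ y R p → eq y (x ∷ R) (↭-trans (swap y x ↭-refl) (prep x p))))

  pairSum-cong : ∀ xs {f g} → (∀ x y R → x ∷ y ∷ R ↭ xs → f x y R ≡ g x y R) → pairSum xs f ≡ pairSum xs g
  pairSum-cong []       eq = refl
  pairSum-cong (x ∷ xs) eq = cong₂ _+_ (selSum-cong xs (λ y R p → eq x y R (prep x p)))
    (pairSum-cong xs (λ y z R p → eq y z (x ∷ R)
      (↭-trans (prep y (swap z x ↭-refl)) (↭-trans (swap y x ↭-refl) (prep x p)))))

  selSum-+ : ∀ xs f g → selSum xs (λ x R → f x R + g x R) ≡ selSum xs f + selSum xs g
  selSum-+ []       f g = refl
  selSum-+ (x ∷ xs) f g =
    trans (cong (f x xs + g x xs +_) (selSum-+ xs _ _)) (eq (f x xs) (g x xs) _ _)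
    where
    eq : ∀ a b c d → a + b + (c + d) ≡ a + c + (b + d)
    eq = solve-∀

  pairSum-+ : ∀ xs f g → pairSum xs (λ x y R → f x y R + g x y R) ≡ pairSum xs f + pairSum xs g
  pairSum-+ []       f g = refl
  pairSum-+ (x ∷ xs) f g =
    trans (cong₂ _+_ (selSum-+ xs (f x) (g x)) (pairSum-+ xs _ _)) (eq (selSum xs (f x)) (selSum xs (g x)) _ _)
    where
    eq : ∀ a b c d → a + b + (c + d) ≡ a + c + (b + d)
    eq = solve-∀

  selSum-* : ∀ c xs f → selSum xs (λ x R → c * f x R) ≡ c * selSum xs f
  selSum-* c []       f = sym (*-zeroʳ c)
  selSum-* c (x ∷ xs) f =
    trans (cong (c * f x xs +_) (selSum-* c xs _)) (sym (*-distribˡ-+ c (f x xs) _))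

  pairSum-* : ∀ c xs f → pairSum xs (λ x y R → c * f x y R) ≡ c * pairSum xs f
  pairSum-* c []       f = sym (*-zeroʳ c)
  pairSum-* c (x ∷ xs) f =
    trans (cong₂ _+_ (selSum-* c xs _) (pairSum-* c xs _)) (sym (*-distribˡ-+ c (selSum xs (f x)) _))

  selSum-const : ∀ xs c → selSum xs (λ _ _ → c) ≡ length xs * c
  selSum-const []       c = refl
  selSum-const (x ∷ xs) c = cong (c +_) (selSum-const xs c)

  pairSum-const : ∀ xs c → pairSum xs (λ _ _ _ → c) ≡ tri (length xs) * c
  pairSum-const []       c = refl
  pairSum-const (x ∷ xs) c =
    trans (cong₂ _+_ (selSum-const xs c) (pairSum-const xs c)) (sym (*-distribʳ-+ c (length xs) _))

  selSum-zero : ∀ xs {f} → (∀ x R → x ∷ R ↭ xs → f x R ≡ 0) → selSum xs f ≡ 0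
  selSum-zero xs eq = trans (selSum-cong xs eq) (trans (selSum-const xs 0) (*-zeroʳ (length xs)))

  pairSum-zero : ∀ xs {f} → (∀ x y R → x ∷ y ∷ R ↭ xs → f x y R ≡ 0) → pairSum xs f ≡ 0
  pairSum-zero xs eq = trans (pairSum-cong xs eq) (trans (pairSum-const xs 0) (*-zeroʳ (tri (length xs))))

  selSum-length : ∀ x xs (c : ℕ → ℕ) f →
    selSum (x ∷ xs) (λ y R → c (length R) * f y R) ≡ c (length xs) * selSum (x ∷ xs) f
  selSum-length x xs c f = trans
    (selSum-cong (x ∷ xs) (λ y R p → cong (λ n → c n * f y R) (suc-injective (↭-length p))))
    (selSum-* (c (length xs)) (x ∷ xs) f)

  pairSum-length : ∀ x y xs (c : ℕ → ℕ) f →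
    pairSum (x ∷ y ∷ xs) (λ z w R → c (length R) * f z w R) ≡ c (length xs) * pairSum (x ∷ y ∷ xs) f
  pairSum-length x y xs c f = trans
    (pairSum-cong (x ∷ y ∷ xs) (λ z w R p →
      cong (λ n → c n * f z w R) (suc-injective (suc-injective (↭-length p)))))
    (pairSum-* (c (length xs)) (x ∷ y ∷ xs) f)

  -- Removing a pair leaves `length xs` - 1 elements; for a one-element list there is no pair, and
  -- `delay` supplies the 0.
  pairSum-delay : ∀ x xs (c : ℕ → ℕ) f →
    pairSum (x ∷ xs) (λ y z R → c (length R) * f y z R) ≡ delay c (length xs) * pairSum (x ∷ xs) f
  pairSum-delay x []       c f = refl
  pairSum-delay x (y ∷ xs) c f = pairSum-length x y xs c f

  pairSum-by-length : ∀ xs (h : ℕ → ℕ) →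
    pairSum xs (λ _ _ R → h (suc (length R))) ≡ tri (length xs) * delay h (length xs)
  pairSum-by-length []           h = refl
  pairSum-by-length (x ∷ [])     h = refl
  pairSum-by-length (x ∷ y ∷ xs) h = trans
    (pairSum-cong (x ∷ y ∷ xs) (λ _ _ R p → cong h (suc-injective (↭-length p))))
    (pairSum-const (x ∷ y ∷ xs) (h (suc (length xs))))

  selSum-by-length : ∀ xs (h : ℕ → ℕ) → selSum xs (λ _ R → h (suc (length R))) ≡ X h (length xs)
  selSum-by-length xs h = trans (selSum-cong xs (λ _ R p → cong h (↭-length p))) (selSum-const xs _)

  selSum-c*length : ∀ x xs c → selSum (x ∷ xs) (λ _ R → c * length R) ≡ c * (length xs * suc (length xs))
  selSum-c*length x xs c = begin
    selSum (x ∷ xs) (λ _ R → c * length R)   ≡⟨ selSum-cong (x ∷ xs) (λ _ R _ → *-comm c (length R)) ⟩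
    selSum (x ∷ xs) (λ _ R → length R * c)   ≡⟨ selSum-length x xs (λ n → n) (λ _ _ → c) ⟩
    length xs * selSum (x ∷ xs) (λ _ _ → c)  ≡⟨ cong (length xs *_) (selSum-const (x ∷ xs) c) ⟩
    length xs * (suc (length xs) * c)     ≡⟨ eq c (length xs) ⟩
    c * (length xs * suc (length xs))     ∎
    where
    open ≡-Reasoning
    eq : ∀ c k → k * (suc k * c) ≡ c * (k * suc k)
    eq = solve-∀

  selSum-∷ʳ : ∀ xs z f → selSum (xs ∷ʳ z) f ≡ selSum xs (λ x R → f x (R ∷ʳ z)) + f z xs
  selSum-∷ʳ []       z f = +-comm (f z []) 0
  selSum-∷ʳ (x ∷ xs) z f =
    trans (cong (f x (xs ∷ʳ z) +_) (selSum-∷ʳ xs z _)) (sym (+-assoc (f x (xs ∷ʳ z)) _ _))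

  pairSum-∷ʳ : ∀ xs z f →
    pairSum (xs ∷ʳ z) f ≡ pairSum xs (λ x y R → f x y (R ∷ʳ z)) + selSum xs (λ x R → f x z R)
  pairSum-∷ʳ []       z f = refl
  pairSum-∷ʳ (x ∷ xs) z f = trans (cong₂ _+_ (selSum-∷ʳ xs z (f x)) (pairSum-∷ʳ xs z _))
    (eq (selSum xs (λ y R → f x y (R ∷ʳ z))) (f x z xs) _ _)
    where
    eq : ∀ a b c d → a + b + (c + d) ≡ a + c + (b + d)
    eq = solve-∀

  module Weights (e : A → ℕ) where

    -- If e marks one tree, w counts the trees of larger root: the partners that keep it on a minimal chain.
    W w : List A → ℕ
    W []       = 0
    W (x ∷ xs) = e x + W xs
    w []       = 0
    w (x ∷ xs) = e x * length xs + w xs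

    selSum-W : ∀ x xs → selSum (x ∷ xs) (λ _ R → W R) ≡ length xs * W (x ∷ xs)
    selSum-W x []       = refl
    selSum-W x (y ∷ xs) = begin
      W (y ∷ xs) + selSum (y ∷ xs) (λ _ R → e x + W R)
        ≡⟨ cong (W (y ∷ xs) +_) (selSum-+ (y ∷ xs) (λ _ _ → e x) (λ _ → W)) ⟩
      W (y ∷ xs) + (selSum (y ∷ xs) (λ _ _ → e x) + selSum (y ∷ xs) (λ _ → W))
        ≡⟨ cong (W (y ∷ xs) +_) (cong₂ _+_ (selSum-const (y ∷ xs) (e x)) (selSum-W y xs)) ⟩
      W (y ∷ xs) + (suc (length xs) * e x + length xs * W (y ∷ xs))
        ≡⟨ eq (W (y ∷ xs)) (length xs) (e x) ⟩
      suc (length xs) * (e x + W (y ∷ xs)) ∎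
      where
      open ≡-Reasoning
      eq : ∀ W k a → W + (suc k * a + k * W) ≡ suc k * (a + W)
      eq = solve-∀

    selSum-e : ∀ xs → selSum xs (λ x _ → e x) ≡ W xs
    selSum-e []       = refl
    selSum-e (x ∷ xs) = cong (e x +_) (selSum-e xs)

    pairSum-e : ∀ xs → pairSum xs (λ x _ _ → e x) ≡ w xs
    pairSum-e []       = refl
    pairSum-e (x ∷ xs) = cong₂ _+_ (trans (selSum-const xs (e x)) (*-comm (length xs) (e x))) (pairSum-e xs)

    selSum-e*length : ∀ x xs → selSum (x ∷ xs) (λ y R → e y * length R) ≡ length xs * W (x ∷ xs)
    selSum-e*length x xs = begin
      selSum (x ∷ xs) (λ y R → e y * length R)
        ≡⟨ selSum-cong (x ∷ xs) (λ y R _ → *-comm (e y) (length R)) ⟩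
      selSum (x ∷ xs) (λ y R → length R * e y)
        ≡⟨ selSum-length x xs (λ n → n) (λ y _ → e y) ⟩
      length xs * selSum (x ∷ xs) (λ y _ → e y)
        ≡⟨ cong (length xs *_) (selSum-e (x ∷ xs)) ⟩
      length xs * W (x ∷ xs) ∎
      where open ≡-Reasoning

    -- `w` counts pairs of a marked tree and a later one. Such a pair survives the removal of any
    -- tree but its own two.
    selSum-w : ∀ x xs → selSum (x ∷ xs) (λ _ R → w R) ≡ (length xs ∸ 1) * w (x ∷ xs)
    selSum-w x []           = refl
    selSum-w x (y ∷ xs) = begin
      w (y ∷ xs) + selSum (y ∷ xs) (λ _ R → e x * length R + w R)
        ≡⟨ cong (w (y ∷ xs) +_) (selSum-+ (y ∷ xs) (λ _ R → e x * length R) (λ _ → w)) ⟩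
      w (y ∷ xs) + (selSum (y ∷ xs) (λ _ R → e x * length R) + selSum (y ∷ xs) (λ _ → w))
        ≡⟨ cong (w (y ∷ xs) +_) (cong₂ _+_ (selSum-c*length y xs (e x)) (selSum-w y xs)) ⟩
      w (y ∷ xs) + (e x * (length xs * suc (length xs)) + (length xs ∸ 1) * w (y ∷ xs))
        ≡⟨ last xs ⟩
      length xs * (e x * suc (length xs) + w (y ∷ xs)) ∎
      where
      open ≡-Reasoning
      eq₀ : ∀ a b → a * 0 + 0 + (b * (0 * 1) + 0) ≡ 0
      eq₀ = solve-∀
      eq : ∀ k a v → v + (a * (suc k * suc (suc k)) + k * v) ≡ suc k * (a * suc (suc k) + v)
      eq = solve-∀
      last : ∀ xs → w (y ∷ xs) + (e x * (length xs * suc (length xs)) + (length xs ∸ 1) * w (y ∷ xs))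
                  ≡ length xs * (e x * suc (length xs) + w (y ∷ xs))
      last []       = eq₀ (e y) (e x)
      last (z ∷ xs) = eq (length xs) (e x) (w (y ∷ z ∷ xs))

    -- The source of `T₀`: the tree joined to N moves to the front, so if it carries the mark, all
    -- trees of R have larger root; otherwise `w` is that of R.
    selSum-join : ∀ x xs →
      selSum (x ∷ xs) (λ y R → e y * length R + w R) ≡ length xs * W (x ∷ xs) + (length xs ∸ 1) * w (x ∷ xs)
    selSum-join x xs = trans (selSum-+ (x ∷ xs) (λ y R → e y * length R) (λ _ → w))
      (cong₂ _+_ (selSum-e*length x xs) (selSum-w x xs))

    pairSum-W : ∀ x xs → pairSum (x ∷ xs) (λ _ _ R → W R) ≡ tri (length xs) * W (x ∷ xs)
    pairSum-W x []       = refl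
    pairSum-W x (y ∷ xs) = begin
      selSum (y ∷ xs) (λ _ → W) + pairSum (y ∷ xs) (λ _ _ R → e x + W R)
        ≡⟨ cong₂ _+_ (selSum-W y xs) (trans (pairSum-+ (y ∷ xs) (λ _ _ _ → e x) (λ _ _ → W))
             (cong₂ _+_ (pairSum-const (y ∷ xs) (e x)) (pairSum-W y xs))) ⟩
      length xs * W (y ∷ xs) + ((length xs + tri (length xs)) * e x + tri (length xs) * W (y ∷ xs))
        ≡⟨ eq (length xs) (W (y ∷ xs)) (tri (length xs)) (e x) ⟩
      (length xs + tri (length xs)) * (e x + W (y ∷ xs)) ∎
      where
      open ≡-Reasoning
      eq : ∀ k W t a → k * W + ((k + t) * a + t * W) ≡ (k + t) * (a + W)
      eq = solve-∀

    -- A mark survives a join if its tree is the smaller of the two, in `w` ways, or is not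
    -- involved, in `tri (length xs)` ways.
    pairSum-join-W : ∀ x xs →
      pairSum (x ∷ xs) (λ y z R → e y + W R) ≡ w (x ∷ xs) + tri (length xs) * W (x ∷ xs)
    pairSum-join-W x xs = trans (pairSum-+ (x ∷ xs) (λ y _ _ → e y) (λ _ _ → W))
      (cong₂ _+_ (pairSum-e (x ∷ xs)) (pairSum-W x xs))

    -- The eigenvalue relation. Let r trees be larger and s smaller than the marked one. Its own
    -- joins bring it to the front and contribute r (r + s - 1); joins of two others use up 0, 1 or
    -- 2 of the larger trees. The total is r (r + s choose 2).
    pairSum-join-w : ∀ x xs →
      pairSum (x ∷ xs) (λ y z R → e y * length R + w R) ≡ tri (length xs) * w (x ∷ xs)
    pairSum-join-w x []       = refl
    pairSum-join-w x (y ∷ xs) = begin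
      selSum (y ∷ xs) (λ _ R → e x * length R + w R)
        + pairSum (y ∷ xs) (λ a b R → e a * suc (length R) + (e x * length R + w R))
        ≡⟨ cong₂ _+_ (trans (selSum-+ (y ∷ xs) (λ _ R → e x * length R) (λ _ → w)) (cong₂ _+_ (selSum-c*length y xs (e x)) (selSum-w y xs))) px ⟩
      (e x * (k * suc k) + (k ∸ 1) * w (y ∷ xs))
        + (w (y ∷ xs) + (tri k * w (y ∷ xs) + pairSum (y ∷ xs) (λ a b R → e x * length R)))
        ≡⟨ last xs ⟩
      (k + tri k) * (e x * suc k + w (y ∷ xs)) ∎
      where
      open ≡-Reasoning
      k : ℕ
      k = length xs
      -- In pairs avoiding x, the tree x stays in the remainder, which makes it longer by one and
      -- adds a term to `w`. Splitting both off leaves the induction hypothesis.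
      px : pairSum (y ∷ xs) (λ a b R → e a * suc (length R) + (e x * length R + w R))
         ≡ w (y ∷ xs) + (tri k * w (y ∷ xs) + pairSum (y ∷ xs) (λ a b R → e x * length R))
      px = begin
        pairSum (y ∷ xs) (λ a b R → e a * suc (length R) + (e x * length R + w R))
          ≡⟨ pairSum-cong (y ∷ xs) (λ a b R _ → r (e a) (length R) (e x) (w R)) ⟩
        pairSum (y ∷ xs) (λ a b R → e a + ((e a * length R + w R) + e x * length R))
          ≡⟨ pairSum-+ (y ∷ xs) (λ a _ _ → e a) (λ a b R → (e a * length R + w R) + e x * length R) ⟩
        pairSum (y ∷ xs) (λ a _ _ → e a) + pairSum (y ∷ xs) (λ a b R → (e a * length R + w R) + e x * length R)
          ≡⟨ cong₂ _+_ (pairSum-e (y ∷ xs)) (pairSum-+ (y ∷ xs) (λ a b R → e a * length R + w R) (λ a b R → e x * length R)) ⟩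
        w (y ∷ xs) + (pairSum (y ∷ xs) (λ a b R → e a * length R + w R) + pairSum (y ∷ xs) (λ a b R → e x * length R))
          ≡⟨ cong (λ q → w (y ∷ xs) + (q + pairSum (y ∷ xs) (λ a b R → e x * length R))) (pairSum-join-w y xs) ⟩
        w (y ∷ xs) + (tri k * w (y ∷ xs) + pairSum (y ∷ xs) (λ a b R → e x * length R)) ∎
        where
        r : ∀ a l b c → a * suc l + (b * l + c) ≡ a + ((a * l + c) + b * l)
        r = solve-∀
      last : ∀ xs → let k = length xs in
        (e x * (k * suc k) + (k ∸ 1) * w (y ∷ xs))
          + (w (y ∷ xs) + (tri k * w (y ∷ xs) + pairSum (y ∷ xs) (λ a b R → e x * length R)))
        ≡ (k + tri k) * (e x * suc k + w (y ∷ xs))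
      last []       = r (e x) (e y)
        where
        r : ∀ a b → a * 0 + 0 + (b * 0 + 0 + 0) ≡ 0
        r = solve-∀
      last (z ∷ xs) = begin
        (e x * (suc j * suc (suc j)) + j * v) + (v + (tri (suc j) * v + pairSum (y ∷ z ∷ xs) (λ a b R → e x * length R)))
          ≡⟨ cong (λ q → (e x * (suc j * suc (suc j)) + j * v) + (v + (tri (suc j) * v + q))) pl ⟩
        (e x * (suc j * suc (suc j)) + j * v) + (v + (tri (suc j) * v + j * ((suc j + tri (suc j)) * e x)))
          ≡⟨ r₁ (e x) j v (tri (suc j)) ⟩
        (suc j + tri (suc j)) * v + e x * (suc j * suc (suc j)) + j * ((suc j + tri (suc j)) * e x)
          ≡⟨ cong (λ q → (suc j + tri (suc j)) * v + e x * q + j * ((suc j + tri (suc j)) * e x))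
               (trans (*-comm (suc j) (suc (suc j))) (sym (2*tri (suc j)))) ⟩
        (suc j + tri (suc j)) * v + e x * (2 * (suc j + tri (suc j))) + j * ((suc j + tri (suc j)) * e x)
          ≡⟨ r₂ (suc j + tri (suc j)) v (e x) j ⟩
        (suc j + tri (suc j)) * (e x * suc (suc j) + v) ∎
        where
        j v : ℕ
        j = length xs
        v = w (y ∷ z ∷ xs)
        pl : pairSum (y ∷ z ∷ xs) (λ a b R → e x * length R) ≡ j * ((suc j + tri (suc j)) * e x)
        pl = begin
          pairSum (y ∷ z ∷ xs) (λ a b R → e x * length R)   ≡⟨ pairSum-cong (y ∷ z ∷ xs) (λ _ _ R _ → *-comm (e x) (length R)) ⟩
          pairSum (y ∷ z ∷ xs) (λ a b R → length R * e x)   ≡⟨ pairSum-length y z xs (λ n → n) (λ _ _ _ → e x) ⟩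
          j * pairSum (y ∷ z ∷ xs) (λ a b R → e x)          ≡⟨ cong (j *_) (pairSum-const (y ∷ z ∷ xs) (e x)) ⟩
          j * ((suc j + tri (suc j)) * e x) ∎
        r₁ : ∀ a j v t → (a * (suc j * suc (suc j)) + j * v) + (v + (t * v + j * ((suc j + t) * a)))
                       ≡ (suc j + t) * v + a * (suc j * suc (suc j)) + j * ((suc j + t) * a)
        r₁ = solve-∀
        r₂ : ∀ t v a j → t * v + a * (2 * t) + j * (t * a) ≡ t * (a * suc (suc j) + v)
        r₂ = solve-∀

-- Counting completions of a forest

≡ᵇ-refl : ∀ n → (n ≡ᵇ n) ≡ true
≡ᵇ-refl n = dec-true (n ≟ n) refl

≢⇒≡ᵇ-false : ∀ {m n} → m ≢ n → (m ≡ᵇ n) ≡ false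
≢⇒≡ᵇ-false {m} {n} = dec-false (m ≟ n)

-- Agrees with `eoc` on increasing trees, and needs no comparison of roots: a join inherits it from
-- its first tree.
leftmost : Tree → ℕ
leftmost (leaf l)     = l
leftmost (node _ x _) = leftmost x

ind : Bool → ℕ
ind b = if b then 1 else 0

eqJust : ℕ → Maybe ℕ → Bool
eqJust p nothing  = false
eqJust p (just x) = x ≡ᵇ p

parentOf-node : ∀ {v} l x y → root x ≢ v → root y ≢ v →
  parentOf v (node l x y) ≡ (parentOf v x <∣> parentOf v y)
parentOf-node {v} l x y x≢ y≢ rewrite ≢⇒≡ᵇ-false x≢ | ≢⇒≡ᵇ-false y≢ with parentOf v x
... | just _  = refl
... | nothing = refl

parentOf-node-leaf : ∀ {v} l x → root x ≢ v → parentOf v (node l x (leaf v)) ≡ just l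
parentOf-node-leaf {v} l x x≢ rewrite ≢⇒≡ᵇ-false x≢ | ≡ᵇ-refl v = refl

module Val (N a p : ℕ) where

  e q : Tree → ℕ
  e t = ind (leftmost t ≡ᵇ a)
  q t = ind (eqJust p (parentOf N t))

  open Weights e

  -- The number of trees with eoc = a and pom = p obtained from a forest by adding the labels i, ..., 1.
  val : ℕ → List Tree → ℕ
  val zero    []          = 0
  val zero    (t ∷ [])    = e t * q t
  val zero    (_ ∷ _ ∷ _) = 0
  val (suc i) F = val i (leaf (suc i) ∷ F) + pairSum F (λ x y R → val i (node (suc i) x y ∷ R))

  e-leaf-≢ : ∀ {i} → i ≢ a → e (leaf i) ≡ 0
  e-leaf-≢ i≢a = cong ind (≢⇒≡ᵇ-false i≢a)

  e-leaf-a : e (leaf a) ≡ 1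
  e-leaf-a = cong ind (≡ᵇ-refl a)

  Tokenless : List Tree → Set
  Tokenless = All (λ t → e t ≡ 0)

  W-tokenless : ∀ {F} → Tokenless F → W F ≡ 0
  W-tokenless []        = refl
  W-tokenless (e0 ∷ es) = cong₂ _+_ e0 (W-tokenless es)

  w-tokenless : ∀ {F} → Tokenless F → w F ≡ 0
  w-tokenless []                    = refl
  w-tokenless {t ∷ F} (e0 ∷ es) = cong₂ _+_ (cong (_* length F) e0) (w-tokenless es)

  tokenless-node : ∀ {F} l x y {R} → x ∷ y ∷ R ↭ F → Tokenless F → Tokenless (node l x y ∷ R)
  tokenless-node l x y perm es with All-resp-↭ (↭-sym perm) es
  ... | ex ∷ _ ∷ eR = ex ∷ eR

  tokenless-join : ∀ {G} l x {R} → x ∷ R ↭ G → Tokenless G → Tokenless (node l x (leaf N) ∷ R)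
  tokenless-join l x perm es with All-resp-↭ (↭-sym perm) es
  ... | ex ∷ eR = ex ∷ eR

  -- The trees of a forest other than leaf N, as long as N has not been joined.
  Open : List Tree → Set
  Open = All (λ t → root t ≢ N × parentOf N t ≡ nothing)

  open-leaf : ∀ {i G} → i ≢ N → Open G → Open (leaf i ∷ G)
  open-leaf i≢N o = (i≢N , refl) ∷ o

  open-node : ∀ {i G} x y {R} → i ≢ N → x ∷ y ∷ R ↭ G → Open G → Open (node i x y ∷ R)
  open-node {i} x y i≢N perm o with All-resp-↭ (↭-sym perm) o
  ... | (x≢ , px) ∷ (y≢ , py) ∷ oR =
    (i≢N , trans (parentOf-node i x y x≢ y≢) (cong₂ _<∣>_ px py)) ∷ oR

  -- A forest in which N has been joined at the label c.
  record Closed (c : ℕ) (F : List Tree) : Set where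
    constructor closed
    field
      roots   : All (λ t → root t ≢ N) F
      parents : All (λ t → parentOf N t ≡ nothing ⊎ parentOf N t ≡ just c) F
      joined  : Any (λ t → parentOf N t ≡ just c) F

  close : ∀ {i G} x {R} → i ≢ N → x ∷ R ↭ G → Open G → Closed i (node i x (leaf N) ∷ R)
  close {i} x i≢N perm o with All-resp-↭ (↭-sym perm) o
  ... | (x≢ , _) ∷ oR = closed (i≢N ∷ All.map proj₁ oR)
    (inj₂ (parentOf-node-leaf i x x≢) ∷ All.map (λ z → inj₁ (proj₂ z)) oR)
    (here (parentOf-node-leaf i x x≢))

  closed-leaf : ∀ {i c F} → i ≢ N → Closed c F → Closed c (leaf i ∷ F)
  closed-leaf i≢N (closed r s j) = closed (i≢N ∷ r) (inj₁ refl ∷ s) (there j)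

  -- `parentOf` prefers the answer of the left subtree, so it matters that every tree answers
  -- `nothing` or `just c`: the left answer can never hide a different one.
  closed-node : ∀ {i c F} x y {R} → i ≢ N → x ∷ y ∷ R ↭ F → Closed c F → Closed c (node i x y ∷ R)
  closed-node {i} {c} x y {R} i≢N perm (closed r s j)
    with All-resp-↭ (↭-sym perm) r | All-resp-↭ (↭-sym perm) s | Any-resp-↭ (↭-sym perm) j
  ... | x≢ ∷ y≢ ∷ r′ | sx ∷ sy ∷ s′ | j′ =
    closed (i≢N ∷ r′) (parents-node sx sy ∷ s′) (joined-node sx j′)
    where
    pn = parentOf-node i x y x≢ y≢
    parents-node : parentOf N x ≡ nothing ⊎ parentOf N x ≡ just c →
      parentOf N y ≡ nothing ⊎ parentOf N y ≡ just c →
      parentOf N (node i x y) ≡ nothing ⊎ parentOf N (node i x y) ≡ just c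
    parents-node (inj₁ px) (inj₁ py) = inj₁ (trans pn (cong₂ _<∣>_ px py))
    parents-node (inj₁ px) (inj₂ py) = inj₂ (trans pn (cong₂ _<∣>_ px py))
    parents-node (inj₂ px) _         = inj₂ (trans pn (cong (_<∣> parentOf N y) px))
    joined-node : parentOf N x ≡ nothing ⊎ parentOf N x ≡ just c →
      Any (λ t → parentOf N t ≡ just c) (x ∷ y ∷ R) → Any (λ t → parentOf N t ≡ just c) (node i x y ∷ R)
    joined-node _         (here px)          = here (trans pn (cong (_<∣> parentOf N y) px))
    joined-node (inj₁ px) (there (here py))  = here (trans pn (cong₂ _<∣>_ px py))
    joined-node (inj₂ px) (there (here py))  = here (trans pn (cong (_<∣> parentOf N y) px))
    joined-node _         (there (there j))  = there j

  q-closed : ∀ {t} → Closed p (t ∷ []) → q t ≡ 1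
  q-closed (closed _ _ (here pt)) = trans (cong (λ m → ind (eqJust p m)) pt) (cong ind (≡ᵇ-refl p))

  val-closed-≢ : ∀ i {c F} → i < N → c ≢ p → Closed c F → val i F ≡ 0
  val-closed-≢ zero    {F = []}        i<N c≢p cl = refl
  val-closed-≢ zero    {F = t ∷ []}    i<N c≢p (closed _ _ (here pt)) =
    trans (cong (λ m → e t * ind (eqJust p m)) pt)
      (trans (cong (λ b → e t * ind b) (≢⇒≡ᵇ-false c≢p)) (*-zeroʳ (e t)))
  val-closed-≢ zero    {F = _ ∷ _ ∷ _} i<N c≢p cl = refl
  val-closed-≢ (suc i) {F = F}         i<N c≢p cl = cong₂ _+_
    (val-closed-≢ i (<⇒≤ i<N) c≢p (closed-leaf (<⇒≢ i<N) cl))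
    (pairSum-zero F (λ x y R perm → val-closed-≢ i (<⇒≤ i<N) c≢p (closed-node x y (<⇒≢ i<N) perm cl)))

  -- An open forest keeps `leaf N` last, N being the largest root. The joins split into those that
  -- leave it alone and those that use it.
  val-∷ʳ : ∀ i G z → val (suc i) (G ∷ʳ z) ≡
    val i ((leaf (suc i) ∷ G) ∷ʳ z) +
    (pairSum G (λ x y R → val i ((node (suc i) x y ∷ R) ∷ʳ z)) + selSum G (λ x R → val i (node (suc i) x z ∷ R)))
  val-∷ʳ i G z = cong (val i ((leaf (suc i) ∷ G) ∷ʳ z) +_) (pairSum-∷ʳ G z _)

  -- Only labels below p remain, so N can no longer be joined at p.
  val-open-late : ∀ i {G} → i < N → i < p → Open G → val i (G ∷ʳ leaf N) ≡ 0
  val-open-late zero    {[]}        i<N i<p o = *-zeroʳ (e (leaf N))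
  val-open-late zero    {_ ∷ []}    i<N i<p o = refl
  val-open-late zero    {_ ∷ _ ∷ _} i<N i<p o = refl
  val-open-late (suc i) {G}         i<N i<p o = trans (val-∷ʳ i G (leaf N)) (cong₂ _+_
    (val-open-late i (<⇒≤ i<N) (<⇒≤ i<p) (open-leaf (<⇒≢ i<N) o)) (cong₂ _+_
    (pairSum-zero G (λ x y R perm → val-open-late i (<⇒≤ i<N) (<⇒≤ i<p) (open-node x y (<⇒≢ i<N) perm o)))
    (selSum-zero G (λ x R perm → val-closed-≢ i (<⇒≤ i<N) (<⇒≢ i<p) (close x (<⇒≢ i<N) perm o)))))

  -- Now neither N nor a imposes a choice any more, and only the survival of the mark counts. By
  -- `pairSum-join-w` the dependence on the forest stays proportional to `w`, and the factor evolves
  -- by `L`. It is indexed by the number of trees other than the marked one, hence `delay`. The seed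
  -- δ₁ says that label 1 must join exactly two trees.
  val-closed : ∀ i {F} → suc i < N → suc i < a → Closed p F →
    val (suc i) F ≡ delay (α (suc i)) (length F) * w F
  val-closed zero {[]} i<N i<a (closed _ _ ())
  val-closed zero {t ∷ []} i<N i<a cl = refl
  val-closed zero {s ∷ t ∷ []} i<N i<a cl = begin
    (e s * q (node 1 s t) + 0) + 0
      ≡⟨ cong (λ z → e s * z + 0 + 0) (q-closed (closed-node s t (<⇒≢ i<N) ↭-refl cl)) ⟩
    (e s * 1 + 0) + 0
      ≡⟨ eq (e s) (e t) ⟩
    1 * (e s * 1 + (e t * 0 + 0)) ∎
    where
    open ≡-Reasoning
    eq : ∀ a b → (a * 1 + 0) + 0 ≡ 1 * (a * 1 + (b * 0 + 0))
    eq = solve-∀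
  val-closed zero {F@(_ ∷ _ ∷ _ ∷ _)} i<N i<a cl = pairSum-zero F val₀
    where
    val₀ : ∀ x y R → x ∷ y ∷ R ↭ F → val 0 (node 1 x y ∷ R) ≡ 0
    val₀ x y []      perm with () ← ↭-length perm
    val₀ x y (_ ∷ _) perm = refl
  val-closed (suc i) {[]} i<N i<a (closed _ _ ())
  val-closed (suc i) {F@(t ∷ F′)} i<N i<a cl = begin
    val (suc i) (leaf (suc (suc i)) ∷ F) + pairSum F (λ x y R → val (suc i) (node (suc (suc i)) x y ∷ R))
      ≡⟨ cong₂ _+_ (val-closed i (<⇒≤ i<N) (<⇒≤ i<a) (closed-leaf (<⇒≢ i<N) cl))
           (pairSum-cong F (λ x y R perm → val-closed i (<⇒≤ i<N) (<⇒≤ i<a) (closed-node x y (<⇒≢ i<N) perm cl))) ⟩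
    h (suc k) * (e (leaf (suc (suc i))) * suc k + w F) + pairSum F (λ x y R → h (length R) * (e x * length R + w R))
      ≡⟨ cong₂ (λ y z → h (suc k) * (y * suc k + w F) + z) (e-leaf-≢ (<⇒≢ i<a)) (pairSum-delay t F′ h (λ x y R → e x * length R + w R)) ⟩
    h (suc k) * w F + delay h k * pairSum F (λ x y R → e x * length R + w R)
      ≡⟨ cong (λ z → h (suc k) * w F + delay h k * z) (pairSum-join-w t F′) ⟩
    h (suc k) * w F + delay h k * (tri k * w F)
      ≡⟨ eq (h (suc k)) (w F) (delay h k) (tri k) ⟩
    (h (suc k) + tri k * delay h k) * w F ∎
    where
    open ≡-Reasoning
    h : ℕ → ℕ
    h = α (suc i)
    k : ℕ
    k = length F′
    eq : ∀ a b c d → a * b + c * (d * b) ≡ (a + d * c) * b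
    eq = solve-∀

  val-closed-tokenless : ∀ i {F} → i < N → i < a → Closed p F → Tokenless F → val i F ≡ 0
  val-closed-tokenless zero    {[]}        i<N i<a cl es       = refl
  val-closed-tokenless zero    {t ∷ []}    i<N i<a cl (et ∷ _) = cong (_* q t) et
  val-closed-tokenless zero    {_ ∷ _ ∷ _} i<N i<a cl es       = refl
  val-closed-tokenless (suc i) {F}         i<N i<a cl es       = trans (val-closed i i<N i<a cl)
    (trans (cong (delay (α (suc i)) (length F) *_) (w-tokenless es)) (*-zeroʳ (delay (α (suc i)) (length F))))

  OpenVal : ℕ → (ℕ → ℕ) → Set
  OpenVal i h = ∀ {G} → Open G → Tokenless G → val i (G ∷ʳ leaf N) ≡ h (length G)

  -- A label above both a and p creates no mark and must not close N, so what remains is a new leaf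
  -- or a join inside `G`.
  open-step : ∀ {i} h → suc i < N → a ≤ i → p ≤ i → OpenVal i h → OpenVal (suc i) (L h)
  open-step {i} h i<N a≤i p≤i val-i {G} o es = begin
    val (suc i) (G ∷ʳ leaf N)
      ≡⟨ val-∷ʳ i G (leaf N) ⟩
    _ ≡⟨ cong₂ _+_ (val-i (open-leaf (<⇒≢ i<N) o) (e-leaf-≢ (>⇒≢ (s≤s a≤i)) ∷ es)) (cong₂ _+_
           (pairSum-cong G (λ x y R perm → val-i (open-node x y (<⇒≢ i<N) perm o) (tokenless-node _ x y perm es)))
           (selSum-zero G (λ x R perm → val-closed-≢ i (<⇒≤ i<N) (>⇒≢ (s≤s p≤i)) (close x (<⇒≢ i<N) perm o)))) ⟩
    h (suc (length G)) + (pairSum G (λ x y R → h (suc (length R))) + 0)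
      ≡⟨ cong (h (suc (length G)) +_) (trans (+-identityʳ _) (pairSum-by-length G h)) ⟩
    h (suc (length G)) + tri (length G) * delay h (length G) ∎
    where open ≡-Reasoning

  open-steps : ∀ s {i} h → s + i < N → a ≤ i → p ≤ i → OpenVal i h → OpenVal (s + i) (fold h L s)
  open-steps zero    h i<N a≤i p≤i val-i = val-i
  open-steps (suc s) {i} h i<N a≤i p≤i val-i =
    open-step (fold h L s) i<N (≤-trans a≤i (m≤n+m i s)) (≤-trans p≤i (m≤n+m i s))
      (open-steps s h (<⇒≤ i<N) a≤i p≤i val-i)

  val-all : ∀ s {i} h → N ≡ suc (s + i) → a ≤ i → p ≤ i → OpenVal i h → val N [] ≡ fold h L s 0
  val-all s h refl a≤i p≤i val-i = trans (+-identityʳ _) (open-steps s h ≤-refl a≤i p≤i val-i [] [])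

module EocBeforePom (N a′ m : ℕ) where

  a p : ℕ
  a = suc a′
  p = suc (m + a)
  open Val N a p
  open Weights e

  -- Label a has to enter as a leaf. It then has the smallest root, so all trees of `F` count in
  -- `w`, which gives the factor `X`.
  val-closed-a : ∀ {F} → a < N → Closed p F → Tokenless F → val a F ≡ X (α a′) (length F)
  val-closed-a = at a′ refl
    where
    joins-vanish : ∀ {F} → a < N → Closed p F → Tokenless F → pairSum F (λ x y R → val a′ (node a x y ∷ R)) ≡ 0
    joins-vanish {F} a<N cl es = pairSum-zero F (λ x y R perm → val-closed-tokenless a′ (<⇒≤ a<N) ≤-refl
      (closed-node x y (<⇒≢ a<N) perm cl) (tokenless-node a x y perm es))
    eq : ∀ h k → h * (1 * k + 0) + 0 ≡ k * h
    eq = solve-∀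
    -- The equation allows a case split on the module parameter `a′`. For a = 1 the new leaf stands
    -- beside a nonempty forest with no label left, so it contributes nothing.
    at : ∀ i → i ≡ a′ → ∀ {F} → a < N → Closed p F → Tokenless F → val (suc i) F ≡ X (α i) (length F)
    at zero    refl {[]}    a<N (closed _ _ ()) es
    at zero    refl {t ∷ F} a<N cl es =
      trans (joins-vanish a<N cl es) (sym (*-zeroʳ (suc (length F))))
    at (suc i) refl {F}     a<N cl es = begin
      val (suc i) (leaf a ∷ F) + pairSum F (λ x y R → val (suc i) (node a x y ∷ R))
        ≡⟨ cong₂ _+_ (val-closed i (<⇒≤ a<N) ≤-refl (closed-leaf (<⇒≢ a<N) cl)) (joins-vanish a<N cl es) ⟩
      α (suc i) (length F) * (e (leaf a) * length F + w F) + 0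
        ≡⟨ cong₂ (λ y z → α (suc i) (length F) * (y * length F + z) + 0) e-leaf-a (w-tokenless es) ⟩
      α (suc i) (length F) * (1 * length F + 0) + 0
        ≡⟨ eq (α (suc i) (length F)) (length F) ⟩
      length F * α (suc i) (length F) ∎
      where open ≡-Reasoning

  val-closed-m : ∀ m′ {F} → m′ + a < N → Closed p F → Tokenless F →
    val (m′ + a) F ≡ fold (X (α a′)) L m′ (length F)
  val-closed-m zero     i<N cl es = val-closed-a i<N cl es
  val-closed-m (suc m′) {F} i<N cl es = cong₂ _+_
    (val-closed-m m′ (<⇒≤ i<N) (closed-leaf (<⇒≢ i<N) cl) (e-leaf-≢ (>⇒≢ (s≤s (m≤n+m a m′))) ∷ es))
    (trans
      (pairSum-cong F (λ x y R perm →
        val-closed-m m′ (<⇒≤ i<N) (closed-node x y (<⇒≢ i<N) perm cl) (tokenless-node _ x y perm es)))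
      (pairSum-by-length F (fold (X (α a′)) L m′)))

  -- N must be joined at exactly this label; the choice of its partner in `G` is the outer `X`.
  val-open-p : p < N → OpenVal p (X (fold (X (α a′)) L m))
  val-open-p p<N {G} o es = begin
    val p (G ∷ʳ leaf N)
      ≡⟨ val-∷ʳ (m + a) G (leaf N) ⟩
    _ ≡⟨ cong₂ _+_ (val-open-late (m + a) (<⇒≤ p<N) ≤-refl (open-leaf (<⇒≢ p<N) o)) (cong₂ _+_
           (pairSum-zero G (λ x y R perm → val-open-late (m + a) (<⇒≤ p<N) ≤-refl (open-node x y (<⇒≢ p<N) perm o)))
           (selSum-cong G (λ x R perm → val-closed-m m (<⇒≤ p<N) (close x (<⇒≢ p<N) perm o)
             (tokenless-join p x perm es)))) ⟩
    selSum G (λ x R → fold (X (α a′)) L m (suc (length R)))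
      ≡⟨ selSum-by-length G (fold (X (α a′)) L m) ⟩
    X (fold (X (α a′)) L m) (length G) ∎
    where
    open ≡-Reasoning

module PomBeforeEoc (N p′ m : ℕ) where

  a p : ℕ
  p = suc p′
  a = suc (m + p)
  open Val N a p
  open Weights e

  -- Here the mark may appear while N is open. The state is indexed by the number of trees other
  -- than `leaf N` and the marked one, and `w` does not count `leaf N`.
  OpenToken : ℕ → State → Set
  OpenToken i (u , v) = ∀ {G} → Open G →
    val i (G ∷ʳ leaf N) ≡ delay u (length G) * W G + delay v (length G) * w G

  val-open-p : p < N → OpenToken p (T₀ p′)
  val-open-p p<N {G} o = begin
    val p (G ∷ʳ leaf N)
      ≡⟨ val-∷ʳ p′ G (leaf N) ⟩
    _ ≡⟨ cong₂ _+_ (val-open-late p′ (<⇒≤ p<N) ≤-refl (open-leaf (<⇒≢ p<N) o)) (cong (_+ S)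
           (pairSum-zero G (λ x y R perm → val-open-late p′ (<⇒≤ p<N) ≤-refl (open-node x y (<⇒≢ p<N) perm o)))) ⟩
    S ≡⟨ at p′ refl G o ⟩
    delay (proj₁ (T₀ p′)) (length G) * W G + delay (proj₂ (T₀ p′)) (length G) * w G ∎
    where
    open ≡-Reasoning
    S : ℕ
    S = selSum G (λ x R → val p′ (node p x (leaf N) ∷ R))
    at : ∀ i → i ≡ p′ → ∀ G → Open G → selSum G (λ x R → val i (node p x (leaf N) ∷ R))
       ≡ delay (proj₁ (T₀ i)) (length G) * W G + delay (proj₂ (T₀ i)) (length G) * w G
    at i refl [] o = refl
    -- With p = 1 no label is left after the join with N. It must produce the whole tree, and the
    -- mark needs no further partner, whence the separate value of `T₀ 0`.
    at zero refl (x ∷ []) o = trans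
      (cong (λ z → e x * z + 0) (q-closed (close x (<⇒≢ p<N) ↭-refl o)))
      (eq (e x))
      where
      eq : ∀ a → a * 1 + 0 ≡ 1 * (a + 0) + 0
      eq = solve-∀
    at zero refl (x ∷ y ∷ G) o = selSum-zero (x ∷ y ∷ G) val₀
      where
      val₀ : ∀ z R → z ∷ R ↭ x ∷ y ∷ G → val 0 (node 1 z (leaf N) ∷ R) ≡ 0
      val₀ z []      perm with () ← ↭-length perm
      val₀ z (_ ∷ _) perm = refl
    at (suc i) refl (x ∷ G) o = begin
      selSum (x ∷ G) (λ y R → val (suc i) (node p y (leaf N) ∷ R))
        ≡⟨ selSum-cong (x ∷ G) (λ y R perm →
             val-closed i (<⇒≤ p<N) (m<n⇒m<1+n (m≤n+m p m)) (close y (<⇒≢ p<N) perm o)) ⟩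
      selSum (x ∷ G) (λ y R → α (suc i) (length R) * (e y * length R + w R))
        ≡⟨ selSum-length x G (α (suc i)) (λ y R → e y * length R + w R) ⟩
      α (suc i) k * selSum (x ∷ G) (λ y R → e y * length R + w R)
        ≡⟨ cong (α (suc i) k *_) (selSum-join x G) ⟩
      α (suc i) k * (k * W (x ∷ G) + (k ∸ 1) * w (x ∷ G))
        ≡⟨ eq (α (suc i) k) k (W (x ∷ G)) (k ∸ 1) (w (x ∷ G)) ⟩
      k * α (suc i) k * W (x ∷ G) + (k ∸ 1) * α (suc i) k * w (x ∷ G) ∎
      where
      k : ℕ
      k = length G
      eq : ∀ h k a l b → h * (k * a + l * b) ≡ k * h * a + l * h * b
      eq = solve-∀

  open-token-step : ∀ {i T} → suc i < N → suc i < a → p ≤ i → OpenToken i T → OpenToken (suc i) (M T)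
  open-token-step {i} {u , v} i<N i<a p≤i val-i {G} o = begin
    val (suc i) (G ∷ʳ leaf N)
      ≡⟨ val-∷ʳ i G (leaf N) ⟩
    _ ≡⟨ cong₂ _+_ (val-i (open-leaf (<⇒≢ i<N) o)) (cong₂ _+_
           (pairSum-cong G (λ x y R perm → val-i (open-node x y (<⇒≢ i<N) perm o)))
           (selSum-zero G (λ x R perm → val-closed-≢ i (<⇒≤ i<N) (>⇒≢ (s≤s p≤i)) (close x (<⇒≢ i<N) perm o)))) ⟩
    u k * (e (leaf (suc i)) + W G) + v k * (e (leaf (suc i)) * k + w G)
      + (pairSum G (λ x y R → u (length R) * (e x + W R) + v (length R) * (e x * length R + w R)) + 0)
      ≡⟨ cong₂ (λ y z → u k * (y + W G) + v k * (y * k + w G) + (z + 0))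
           (e-leaf-≢ (<⇒≢ i<a))
           (pairSum-+ G (λ x y R → u (length R) * (e x + W R)) (λ x y R → v (length R) * (e x * length R + w R))) ⟩
    u k * W G + v k * w G
      + (pairSum G (λ x y R → u (length R) * (e x + W R)) + pairSum G (λ x y R → v (length R) * (e x * length R + w R)) + 0)
      ≡⟨ collect G ⟩
    delay (L u) k * W G + delay (proj₂ (M (u , v))) k * w G ∎
    where
    open ≡-Reasoning
    k : ℕ
    k = length G
    eq₀ : ∀ a b → a * 0 + b * 0 + 0 ≡ 0
    eq₀ = solve-∀
    eq : ∀ u₁ W v₁ w t u₀ v₀ → u₁ * W + v₁ * w + (u₀ * (w + t * W) + v₀ * (t * w) + 0)
       ≡ (u₁ + t * u₀) * W + (v₁ + t * v₀ + u₀) * w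
    eq = solve-∀
    collect : ∀ G → u (length G) * W G + v (length G) * w G
      + (pairSum G (λ x y R → u (length R) * (e x + W R)) + pairSum G (λ x y R → v (length R) * (e x * length R + w R)) + 0)
      ≡ delay (L u) (length G) * W G + delay (proj₂ (M (u , v))) (length G) * w G
    collect []      = eq₀ (u 0) (v 0)
    collect (x ∷ G) = trans
      (cong₂ (λ y z → u (suc l) * W (x ∷ G) + v (suc l) * w (x ∷ G) + (y + z + 0))
        (trans (pairSum-delay x G u (λ x y R → e x + W R)) (cong (delay u l *_) (pairSum-join-W x G)))
        (trans (pairSum-delay x G v (λ x y R → e x * length R + w R)) (cong (delay v l *_) (pairSum-join-w x G))))
      (eq (u (suc l)) (W (x ∷ G)) (v (suc l)) (w (x ∷ G)) (tri l) (delay u l) (delay v l))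
      where
      l : ℕ
      l = length G

  open-token-steps : ∀ s → s + p < N → s + p < a → OpenToken (s + p) (fold (T₀ p′) M s)
  open-token-steps zero    i<N i<a = val-open-p i<N
  open-token-steps (suc s) i<N i<a =
    open-token-step i<N i<a (m≤n+m p s) (open-token-steps s (<⇒≤ i<N) (<⇒≤ i<a))

  -- The new leaf has the smallest root, so `W` becomes 1 and `w` becomes `length G`. If a is a join
  -- instead, no mark can appear later.
  val-open-a : a < N → let (u , v) = fold (T₀ p′) M m in OpenVal a (λ x → u x + X v x)
  val-open-a a<N {G} o es = begin
    val a (G ∷ʳ leaf N)
      ≡⟨ val-∷ʳ (m + p) G (leaf N) ⟩
    _ ≡⟨ cong₂ _+_ (val-i (open-leaf (<⇒≢ a<N) o)) (cong₂ _+_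
           (pairSum-zero G val₀)
           (selSum-zero G (λ x R perm → val-closed-≢ (m + p) (<⇒≤ a<N) (>⇒≢ (s≤s (m≤n+m p m))) (close x (<⇒≢ a<N) perm o)))) ⟩
    u k * (e (leaf a) + W G) + v k * (e (leaf a) * k + w G) + 0
      ≡⟨ cong (λ y → u k * (y + W G) + v k * (y * k + w G) + 0) e-leaf-a ⟩
    u k * (1 + W G) + v k * (1 * k + w G) + 0
      ≡⟨ cong₂ (λ y z → u k * (1 + y) + v k * (1 * k + z) + 0) (W-tokenless es) (w-tokenless es) ⟩
    u k * (1 + 0) + v k * (1 * k + 0) + 0
      ≡⟨ eq (u k) (v k) k ⟩
    u k + k * v k ∎
    where
    open ≡-Reasoning
    u v : ℕ → ℕ
    u = proj₁ (fold (T₀ p′) M m)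
    v = proj₂ (fold (T₀ p′) M m)
    k : ℕ
    k = length G
    val-i : OpenToken (m + p) (fold (T₀ p′) M m)
    val-i = open-token-steps m (<⇒≤ a<N) ≤-refl
    eq : ∀ u v k → u * (1 + 0) + v * (1 * k + 0) + 0 ≡ u + k * v
    eq = solve-∀
    eq₀ : ∀ u v → u * 0 + v * 0 ≡ 0
    eq₀ = solve-∀
    val₀ : ∀ x y R → x ∷ y ∷ R ↭ G → val (m + p) ((node a x y ∷ R) ∷ʳ leaf N) ≡ 0
    val₀ x y R perm = let es′ = tokenless-node a x y perm es in trans
      (val-i (open-node x y (<⇒≢ a<N) perm o))
      (trans (cong₂ (λ y z → u (length R) * y + v (length R) * z) (W-tokenless es′) (w-tokenless es′))
        (eq₀ (u (length R)) (v (length R))))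

fold-L-zero : ∀ s x → fold (λ _ → 0) L s x ≡ 0
fold-L-zero zero    x       = refl
fold-L-zero (suc s) zero    = cong (_+ 0) (fold-L-zero s 1)
fold-L-zero (suc s) (suc x) = cong₂ _+_ (fold-L-zero s (suc (suc x)))
  (trans (cong (tri (suc x) *_) (fold-L-zero s x)) (*-zeroʳ (tri (suc x))))

module EocIsPom (N p′ : ℕ) where

  p : ℕ
  p = suc p′
  open Val N p p

  -- The parent of N is an internal vertex and cannot also be the leaf that ends the chain.
  val-open-p : p < N → OpenVal p (λ _ → 0)
  val-open-p p<N {G} o es = trans (val-∷ʳ p′ G (leaf N)) (cong₂ _+_
    (val-open-late p′ (<⇒≤ p<N) ≤-refl (open-leaf (<⇒≢ p<N) o)) (cong₂ _+_
    (pairSum-zero G (λ x y R perm → val-open-late p′ (<⇒≤ p<N) ≤-refl (open-node x y (<⇒≢ p<N) perm o)))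
    (selSum-zero G (λ x R perm → val-closed-tokenless p′ (<⇒≤ p<N) ≤-refl
      (close x (<⇒≢ p<N) perm o) (tokenless-join p x perm es)))))

module _ (s m t : ℕ) where

  size : ℕ
  size = suc (s + suc (m + suc t))

  <size : suc (m + suc t) < size
  <size = s≤s (m≤n+m _ s)

  val-< : Val.val size (suc t) (suc (m + suc t)) size [] ≡ count< s m t
  val-< = val-all s (X (fold (X (α t)) L m)) refl (m≤n⇒m≤1+n (m≤n+m (suc t) m)) ≤-refl (val-open-p <size)
    where
    open Val size (suc t) (suc (m + suc t))
    open EocBeforePom size t m

  val-> : Val.val size (suc (m + suc t)) (suc t) size [] ≡ count> s m t
  val-> = val-all s (λ x → proj₁ (fold (T₀ t) M m) x + X (proj₂ (fold (T₀ t) M m)) x) refl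
    ≤-refl (m≤n⇒m≤1+n (m≤n+m (suc t) m)) (val-open-a <size)
    where
    open Val size (suc (m + suc t)) (suc t)
    open PomBeforeEoc size t m

val-≡ : ∀ s t → let N = suc (s + suc t) in Val.val N (suc t) (suc t) N [] ≡ 0
val-≡ s t = trans (val-all s (λ _ → 0) refl ≤-refl ≤-refl (val-open-p (s≤s (m≤n+m _ s))))
  (fold-L-zero s 0)
  where
  open Val (suc (s + suc t)) (suc t) (suc t)
  open EocIsPom (suc (s + suc t)) t

private
  ∸-swap : ∀ s m t → suc (s + suc (m + suc t)) ∸ suc t ≡ suc (m + suc s)
  ∸-swap s m t = trans (cong (_∸ t) (eq s m t)) (m+n∸n≡m (suc (m + suc s)) t)
    where
    eq : ∀ s m t → s + suc (m + suc t) ≡ suc (m + suc s) + t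
    eq = solve-∀

  size-swap : ∀ s m t → size s m t ≡ size t m s
  size-swap = eq
    where
    eq : ∀ s m t → suc (s + suc (m + suc t)) ≡ suc (t + suc (m + suc s))
    eq = solve-∀

val-sym-< : ∀ {n a b} s m t → a ≡ suc t → b ≡ suc s → n ≡ size s m t →
  Val.val n a (n ∸ b) n [] ≡ Val.val n b (n ∸ a) n []
val-sym-< s m t refl refl refl = begin
  Val.val (size s m t) (suc t) (size s m t ∸ suc s) (size s m t) []
    ≡⟨ cong (λ p → Val.val (size s m t) (suc t) p (size s m t) []) (m+n∸m≡n s (suc (m + suc t))) ⟩
  Val.val (size s m t) (suc t) (suc (m + suc t)) (size s m t) []
    ≡⟨ val-< s m t ⟩
  count< s m t
    ≡⟨ count<-sym s m t ⟩
  count< t m s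
    ≡⟨ val-< t m s ⟨
  Val.val (size t m s) (suc s) (suc (m + suc s)) (size t m s) []
    ≡⟨ cong₂ (λ n p → Val.val n (suc s) p n []) (size-swap s m t) (∸-swap s m t) ⟨
  Val.val (size s m t) (suc s) (size s m t ∸ suc t) (size s m t) [] ∎
  where open ≡-Reasoning

val-sym-> : ∀ {n a b} s m t → a ≡ suc (m + suc t) → b ≡ suc (m + suc s) → n ≡ size s m t →
  Val.val n a (n ∸ b) n [] ≡ Val.val n b (n ∸ a) n []
val-sym-> s m t refl refl refl = begin
  Val.val (size s m t) (suc (m + suc t)) (size s m t ∸ suc (m + suc s)) (size s m t) []
    ≡⟨ cong (λ p → Val.val (size s m t) (suc (m + suc t)) p (size s m t) [])
         (trans (cong (_∸ suc (m + suc s)) (size-swap s m t)) (m+n∸n≡m (suc t) (suc (m + suc s)))) ⟩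
  Val.val (size s m t) (suc (m + suc t)) (suc t) (size s m t) []
    ≡⟨ val-> s m t ⟩
  count> s m t
    ≡⟨ count>-sym s m t ⟩
  count> t m s
    ≡⟨ val-> t m s ⟨
  Val.val (size t m s) (suc (m + suc s)) (suc s) (size t m s) []
    ≡⟨ cong₂ (λ n p → Val.val n (suc (m + suc s)) p n []) (size-swap s m t) (m+n∸n≡m (suc s) (suc (m + suc t))) ⟨
  Val.val (size s m t) (suc (m + suc s)) (size s m t ∸ suc (m + suc t)) (size s m t) [] ∎
  where open ≡-Reasoning

val-sym-≡ : ∀ {n a b} s t → a ≡ suc t → b ≡ suc s → n ≡ suc (s + suc t) →
  Val.val n a (n ∸ b) n [] ≡ Val.val n b (n ∸ a) n []
val-sym-≡ s t refl refl refl = trans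
  (trans (cong (λ p → Val.val n (suc t) p n []) (m+n∸m≡n s (suc t))) (val-≡ s t))
  (sym (trans (cong₂ (λ n p → Val.val n (suc s) p n []) n≡ (m+n∸n≡m (suc s) (suc t)))
    (val-≡ t s)))
  where
  n : ℕ
  n = suc (s + suc t)
  eq : ∀ s t → suc (s + suc t) ≡ suc (t + suc s)
  eq = solve-∀
  n≡ : n ≡ suc (t + suc s)
  n≡ = eq s t

-- With p = n - b, the condition a < n - b is symmetric in a and b, so the exchange stays within
-- each of the three cases; it swaps s and t and fixes m.
val-sym : ∀ {n a b} → 1 ≤ a → a < n → 1 ≤ b → b < n →
  Val.val n a (n ∸ b) n [] ≡ Val.val n b (n ∸ a) n []
val-sym {n} {suc t} {suc s} _ a<n _ b<n with <-cmp (suc t) (n ∸ suc s)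
... | tri< a<p _ _ with m≤n⇒∃[o]m+o≡n a<p
... | m , a+m≡p = val-sym-< s m t refl refl
  (trans (sym (m+[n∸m]≡n (<⇒≤ b<n))) (trans (cong (suc s +_) (sym a+m≡p)) (eq s t m)))
  where
  eq : ∀ s t m → suc s + (suc (suc t) + m) ≡ suc (s + suc (m + suc t))
  eq = solve-∀
val-sym {n} {suc t} {suc s} _ a<n _ b<n | tri≈ _ a≡p _ = val-sym-≡ s t refl refl
  (trans (sym (m+[n∸m]≡n (<⇒≤ b<n))) (cong (suc s +_) (sym a≡p)))
val-sym {n} {a} {b} _ a<n _ b<n | tri> _ _ a>p
  with m≤n⇒∃[o]m+o≡n a<n | m≤n⇒∃[o]m+o≡n a>p | m≤n⇒∃[o]m+o≡n (m<n⇒0<n∸m b<n)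
... | s , a+s≡n | m , p+m≡a | t , 1+t≡p = val-sym-> s m t a≡ (+-cancelʳ-≡ (suc t) _ _ b+p≡) n≡
  where
  open ≡-Reasoning
  a≡ : a ≡ suc (m + suc t)
  a≡ = trans (sym p+m≡a) (cong suc (trans (+-comm (n ∸ b) m) (cong (m +_) (sym 1+t≡p))))
  n≡ : n ≡ suc (s + suc (m + suc t))
  n≡ = trans (sym a+s≡n) (cong suc (trans (+-comm a s) (cong (s +_) a≡)))
  eq : ∀ s m t → suc (s + suc (m + suc t)) ≡ suc (m + suc s) + suc t
  eq = solve-∀
  b+p≡ : b + suc t ≡ suc (m + suc s) + suc t
  b+p≡ = begin
    b + suc t                    ≡⟨ cong (b +_) 1+t≡p ⟩
    b + (n ∸ b)                  ≡⟨ m+[n∸m]≡n (<⇒≤ b<n) ⟩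
    n                            ≡⟨ n≡ ⟩
    suc (s + suc (m + suc t))    ≡⟨ eq s m t ⟩
    suc (m + suc s) + suc t ∎

-- Enumeration of trees

module _ {A : Set} where

  select : List A → List (A × List A)
  select []       = []
  select (x ∷ xs) = (x , xs) ∷ map (map₂ (x ∷_)) (select xs)

  pairs : List A → List (A × A × List A)
  pairs []       = []
  pairs (x ∷ xs) = map (x ,_) (select xs) ++ map (map₂ (map₂ (x ∷_))) (pairs xs)

  sum-select : ∀ xs (f : A → List A → ℕ) → sum (map (λ (y , R) → f y R) (select xs)) ≡ selSum xs f
  sum-select []       f = refl
  sum-select (x ∷ xs) f = cong (f x xs +_)
    (trans (cong sum (sym (map-∘ (select xs)))) (sum-select xs _))

  sum-pairs : ∀ xs (f : A → A → List A → ℕ) → sum (map (λ (y , z , R) → f y z R) (pairs xs)) ≡ pairSum xs f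
  sum-pairs []       f = refl
  sum-pairs (x ∷ xs) f = begin
    sum (map g (map (x ,_) (select xs) ++ map (map₂ (map₂ (x ∷_))) (pairs xs)))
      ≡⟨ cong sum (map-++ g (map (x ,_) (select xs)) _) ⟩
    sum (map g (map (x ,_) (select xs)) ++ map g (map (map₂ (map₂ (x ∷_))) (pairs xs)))
      ≡⟨ sum-++ (map g (map (x ,_) (select xs))) _ ⟩
    sum (map g (map (x ,_) (select xs))) + sum (map g (map (map₂ (map₂ (x ∷_))) (pairs xs)))
      ≡⟨ cong₂ _+_ (cong sum (sym (map-∘ (select xs)))) (cong sum (sym (map-∘ (pairs xs)))) ⟩
    sum (map (λ (y , R) → f x y R) (select xs)) + sum (map (λ (y , z , R) → f y z (x ∷ R)) (pairs xs))
      ≡⟨ cong₂ _+_ (sum-select xs (f x)) (sum-pairs xs _) ⟩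
    selSum xs (f x) + pairSum xs (λ y z R → f y z (x ∷ R)) ∎
    where
    open ≡-Reasoning
    g : A × A × List A → ℕ
    g (y , z , R) = f y z R

  select-↭ : ∀ {xs x R} → (x , R) ∈ select xs → x ∷ R ↭ xs
  select-↭ {_ ∷ _} (here refl) = ↭-refl
  select-↭ {y ∷ xs} (there p) with ∈-map⁻ _ p
  ... | (x , R) , q , refl = ↭-trans (swap x y ↭-refl) (prep y (select-↭ q))

  pairs-↭ : ∀ {xs x y R} → (x , y , R) ∈ pairs xs → x ∷ y ∷ R ↭ xs
  pairs-↭ {z ∷ xs} p with ∈-++⁻ (map (z ,_) (select xs)) p
  ... | inj₁ q with ∈-map⁻ _ q
  ...   | (y , R) , r , refl = prep z (select-↭ r)
  pairs-↭ {z ∷ xs} p | inj₂ q with ∈-map⁻ _ q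
  ...   | (x , y , R) , r , refl =
    ↭-trans (prep x (swap y z ↭-refl)) (↭-trans (swap x z ↭-refl) (prep z (pairs-↭ r)))

  module _ {_≺_ : A → A → Set} where

    select-AllPairs : ∀ {xs x R} → AllPairs _≺_ xs → (x , R) ∈ select xs → AllPairs _≺_ R
    select-AllPairs (_ ∷ s) (here refl) = s
    select-AllPairs (a ∷ s) (there p) with ∈-map⁻ _ p
    ... | (x , R) , q , refl = All.tail (All-resp-↭ (↭-sym (select-↭ q)) a) ∷ select-AllPairs s q

    pairs-AllPairs : ∀ {xs x y R} → AllPairs _≺_ xs → (x , y , R) ∈ pairs xs → x ≺ y × AllPairs _≺_ R
    pairs-AllPairs {z ∷ xs} (a ∷ s) p with ∈-++⁻ (map (z ,_) (select xs)) p
    ... | inj₁ q with ∈-map⁻ _ q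
    ...   | (y , R) , r , refl = All.head (All-resp-↭ (↭-sym (select-↭ r)) a) , select-AllPairs s r
    pairs-AllPairs {z ∷ xs} (a ∷ s) p | inj₂ q with ∈-map⁻ _ q
    ...   | (x , y , R) , r , refl with pairs-AllPairs s r
    ...     | x≺y , s′ = x≺y , All.tail (All.tail (All-resp-↭ (↭-sym (pairs-↭ r)) a)) ∷ s′

  select-Unique : ∀ {xs} → Unique xs → Unique (select xs)
  select-Unique []                    = []
  select-Unique {x ∷ xs} (x∉ ∷ u) =
    All.tabulate (λ p eq → distinct p eq) ∷ Uniq.map⁺ (λ { refl → refl }) (select-Unique u)
    where
    distinct : ∀ {p} → p ∈ map (map₂ (x ∷_)) (select xs) → (x , xs) ≢ p
    distinct p eq with ∈-map⁻ _ p
    distinct p refl | (y , R) , q , eq = All.lookup x∉ (∈-resp-↭ (select-↭ q) (here refl)) (cong proj₁ eq)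

  pairs-Unique : ∀ {xs} → Unique xs → Unique (pairs xs)
  pairs-Unique []                = []
  pairs-Unique {x ∷ xs} (x∉ ∷ u) = Uniq.++⁺
    (Uniq.map⁺ (λ { refl → refl }) (select-Unique u))
    (Uniq.map⁺ (λ { refl → refl }) (pairs-Unique u))
    disjoint
    where
    disjoint : Disjoint (map (x ,_) (select xs)) (map (map₂ (map₂ (x ∷_))) (pairs xs))
    disjoint (p , q) with ∈-map⁻ _ p | ∈-map⁻ _ q
    ... | _ , _ , refl | (y , z , R) , r , eq =
      All.lookup x∉ (∈-resp-↭ (pairs-↭ r) (here refl)) (cong proj₁ eq)

  Unique-resp-↭ : ∀ {xs ys : List A} → xs ↭ ys → Unique xs → Unique ys
  Unique-resp-↭ p = PermSetoid.Unique-resp-↭ (setoid A) (↭⇒↭ₛ p)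

  Unique-++⇒Disjoint : ∀ xs {ys : List A} → Unique (xs ++ ys) → Disjoint xs ys
  Unique-++⇒Disjoint (x ∷ xs) (x∉ ∷ u) (here refl , q) = All.lookup x∉ (∈-++⁺ʳ xs q) refl
  Unique-++⇒Disjoint (x ∷ xs) (x∉ ∷ u) (there p , q)   = Unique-++⇒Disjoint xs u (p , q)

  -- `r` recovers from an element the block it came from, so distinct blocks are disjoint.
  concatMap-Unique : ∀ {B : Set} {g : B → List A} (r : A → B) {xs} → Unique xs →
    (∀ {x} → x ∈ xs → Unique (g x)) → (∀ {x t} → x ∈ xs → t ∈ g x → r t ≡ x) → Unique (concatMap g xs)
  concatMap-Unique r [] ug rg = []
  concatMap-Unique {g = g} r {x ∷ xs} (x∉ ∷ u) ug rg = Uniq.++⁺ (ug (here refl))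
    (concatMap-Unique r u (λ p → ug (there p)) (λ p → rg (there p)))
    λ (p , q) → let (y , y∈ , t∈) = find (∈-concatMap⁻ g {xs = xs} q) in
      All.lookup x∉ y∈ (trans (sym (rg (here refl) p)) (rg (there y∈) t∈))

  -- Pigeonhole: a duplicate-free `L` contained in a list of the same length fills it and leaves no
  -- room for repetitions.
  covering-↭ : ∀ {xs} L → Unique L → (∀ {k} → k ∈ L → k ∈ xs) → length xs ≡ length {A = A} L → xs ↭ L
  covering-↭ {[]}    []      u c eq = ↭-refl
  covering-↭ (k ∷ L) (k∉ ∷ u) c eq with ∈-∃++ (c (here refl))
  ... | ys , zs , refl = ↭-trans (shift k ys zs) (prep k (covering-↭ L u c′
          (suc-injective (trans (sym (↭-length (shift k ys zs))) eq))))
    where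
    c′ : ∀ {j} → j ∈ L → j ∈ ys ++ zs
    c′ j∈ with ∈-resp-↭ (shift k ys zs) (c (there j∈))
    ... | here j≡k = ⊥-elim (All.lookup k∉ j∈ (sym j≡k))
    ... | there p  = p

  lookup-injective : ∀ {xs : List A} → Unique xs → ∀ i j → lookup xs i ≡ lookup xs j → i ≡ j
  lookup-injective (x∉ ∷ u) Fin.zero    Fin.zero    eq = refl
  lookup-injective (x∉ ∷ u) Fin.zero    (Fin.suc j) eq = ⊥-elim (All.lookup x∉ (∈-lookup j) eq)
  lookup-injective (x∉ ∷ u) (Fin.suc i) Fin.zero    eq = ⊥-elim (All.lookup x∉ (∈-lookup i) (sym eq))
  lookup-injective (x∉ ∷ u) (Fin.suc i) (Fin.suc j) eq = cong Fin.suc (lookup-injective u i j eq)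

  -- `irrelevant` ensures that `Σ A P` is no larger than the list: one element does not carry
  -- several proofs.
  record Enumerates (P : A → Set) (xs : List A) : Set where
    field
      irrelevant : ∀ {t} (p q : P t) → p ≡ q
      unique     : Unique xs
      complete   : ∀ {t} → P t → t ∈ xs
      sound      : ∀ {t} → t ∈ xs → P t

  transfer : ∀ {P Q : A → Set} {xs ys} → Enumerates P xs → Enumerates Q ys →
    length xs ≡ length ys → Σ A P → Σ A Q
  transfer {ys = ys} E F eq (t , p) =
    lookup ys (cast eq (index (Enumerates.complete E p))) , Enumerates.sound F (∈-lookup _)

  transfer-inverse : ∀ {P Q : A → Set} {xs ys} (E : Enumerates P xs) (F : Enumerates Q ys)
    (eq : length xs ≡ length ys) (eq′ : length ys ≡ length xs) → ∀ t → transfer F E eq′ (transfer E F eq t) ≡ t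
  transfer-inverse {xs = xs} {ys} E F eq eq′ (t , p) = Σ-≡ (begin
    lookup xs (cast eq′ (index j∈))
      ≡⟨ cong (lookup xs ∘ cast eq′) (lookup-injective (Enumerates.unique F) _ _ (sym (lookup-index j∈))) ⟩
    lookup xs (cast eq′ (cast eq (index t∈)))
      ≡⟨ cong (lookup xs) (cast-involutive eq′ eq (index t∈)) ⟩
    lookup xs (index t∈)
      ≡⟨ lookup-index t∈ ⟨
    t ∎)
    where
    open ≡-Reasoning
    t∈ = Enumerates.complete E p
    j∈ = Enumerates.complete F (proj₂ (transfer E F eq (t , p)))
    Σ-≡ : ∀ {s s′ p p′} → s ≡ s′ → (s , p) ≡ (s′ , p′)
    Σ-≡ refl = cong (_ ,_) (Enumerates.irrelevant E _ _)

  Enumerates-↔ : ∀ {P Q : A → Set} {xs ys} → Enumerates P xs → Enumerates Q ys →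
    length xs ≡ length ys → Σ A P ↔ Σ A Q
  Enumerates-↔ E F eq = mk↔ₛ′ (transfer E F eq) (transfer F E (sym eq))
    (transfer-inverse F E (sym eq) eq) (transfer-inverse E F eq (sym eq))

-- Increasing trees and the building process

T-<ᵇ : ∀ {m n} → T (m <ᵇ n) → m < n
T-<ᵇ {m} {n} = <ᵇ⇒< m n

∧⁻ : ∀ {x y} → T (x ∧ y) → T x × T y
∧⁻ = Equivalence.to T-∧

∧⁺ : ∀ {x y} → T x → T y → T (x ∧ y)
∧⁺ p q = Equivalence.from T-∧ (p , q)

increasing-node⁻ : ∀ {l x y} → T (increasing (node l x y)) →
  l < root x × l < root y × root x < root y × T (increasing x) × T (increasing y)
increasing-node⁻ i with ∧⁻ i
... | a , i₁ with ∧⁻ i₁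
... | b , i₂ with ∧⁻ i₂
... | c , i₃ with ∧⁻ i₃
... | d , e = T-<ᵇ a , T-<ᵇ b , T-<ᵇ c , d , e

increasing-node⁺ : ∀ {l x y} → l < root x → l < root y → root x < root y →
  T (increasing x) → T (increasing y) → T (increasing (node l x y))
increasing-node⁺ a b c d e = ∧⁺ (<⇒<ᵇ a) (∧⁺ (<⇒<ᵇ b) (∧⁺ (<⇒<ᵇ c) (∧⁺ d e)))

root∈labels : ∀ t → root t ∈ labels t
root∈labels (leaf _)     = here refl
root∈labels (node _ _ _) = here refl

root-minimal : ∀ t {l} → T (increasing t) → l ∈ labels t → root t ≤ l
root-minimal (leaf _)     i (here refl) = ≤-refl
root-minimal (node l x y) i (here refl) = ≤-refl
root-minimal (node l x y) i (there p) with increasing-node⁻ {l} {x} {y} i | ∈-++⁻ (labels x) p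
... | a , b , c , d , e | inj₁ q = ≤-trans (<⇒≤ a) (root-minimal x d q)
... | a , b , c , d , e | inj₂ q = ≤-trans (<⇒≤ b) (root-minimal y e q)

_≺_ : Tree → Tree → Set
s ≺ t = root s < root t

labelsF : List Tree → List ℕ
labelsF = concatMap labels

labelsF-↭ : ∀ {F F′} → F ↭ F′ → labelsF F ↭ labelsF F′
labelsF-↭ Perm.refl         = ↭-refl
labelsF-↭ (prep t p)        = ++⁺ˡ (labels t) (labelsF-↭ p)
labelsF-↭ (swap s t p)      =
  ↭-trans (shifts (labels s) (labels t)) (++⁺ˡ (labels t) (++⁺ˡ (labels s) (labelsF-↭ p)))
labelsF-↭ (Perm.trans p q)  = ↭-trans (labelsF-↭ p) (labelsF-↭ q)

root∈labelsF : ∀ {t F} → t ∈ F → root t ∈ labelsF F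
root∈labelsF {F = t ∷ F} (here refl) = ∈-++⁺ˡ (root∈labels t)
root∈labelsF {F = t ∷ F} (there p)   = ∈-++⁺ʳ (labels t) (root∈labelsF p)

range : ℕ → ℕ → List ℕ
range s zero    = []
range s (suc d) = suc s ∷ range (suc s) d

∈-range⁻ : ∀ {l} s d → l ∈ range s d → s < l × l ≤ s + d
∈-range⁻ s (suc d) (here refl) = ≤-refl , ≤-trans (s≤s (m≤m+n s d)) (≤-reflexive (sym (+-suc s d)))
∈-range⁻ s (suc d) (there p) with ∈-range⁻ (suc s) d p
... | a , b = <⇒≤ a , ≤-trans b (≤-reflexive (sym (+-suc s d)))

∈-range⁺ : ∀ {l} s d → s < l → l ≤ s + d → l ∈ range s d
∈-range⁺ s zero    s<l l≤ = ⊥-elim (<⇒≱ s<l (subst (_ ≤_) (+-identityʳ s) l≤))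
∈-range⁺ {l} s (suc d) s<l l≤ with l ≟ suc s
... | yes refl = here refl
... | no  l≢   = there (∈-range⁺ (suc s) d (≤∧≢⇒< s<l (l≢ ∘ sym)) (subst (l ≤_) (+-suc s d) l≤))

length-range : ∀ s d → length (range s d) ≡ d
length-range s zero    = refl
length-range s (suc d) = cong suc (length-range (suc s) d)

range-Unique : ∀ s d → Unique (range s d)
range-Unique s zero    = []
range-Unique s (suc d) =
  All.tabulate (λ p → <⇒≢ (proj₁ (∈-range⁻ (suc s) d p))) ∷ range-Unique (suc s) d

-- A forest carrying the labels s + 1, ..., s + d.
record Good (s d : ℕ) (F : List Tree) : Set where
  constructor good
  field
    sorted : AllPairs _≺_ F
    incr   : All (λ t → T (increasing t)) F
    labs   : labelsF F ↭ range s d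
open Good

Good-root : ∀ {s d F t} → Good s d F → t ∈ F → s < root t
Good-root {s} {d} g t∈ = proj₁ (∈-range⁻ s d (∈-resp-↭ (labs g) (root∈labelsF t∈)))

-- The smallest label can only sit at a root, and sortedness brings that root to the front. Hence
-- `unstep` may look at the first tree alone.
Good-head : ∀ {s d F} → Good s (suc d) F → ∃ λ t → ∃ λ R → F ≡ t ∷ R × root t ≡ suc s
Good-head {s} {F = []} g with () ← ↭-length (labs g)
Good-head {s} {F = t ∷ R} g = t , R , refl , root≡
  where
  s∈ = ∈-resp-↭ (↭-sym (labs g)) (here refl)
  root≡ : root t ≡ suc s
  root≡ with find (∈-concatMap⁻ labels {xs = t ∷ R} s∈)
  ... | t′ , t′∈ , l∈ with ≤-antisym (root-minimal t′ (All.lookup (incr g) t′∈) l∈) (Good-root g t′∈)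
  ... | eq with t′∈ | sorted g
  ... | here refl | _     = eq
  ... | there p   | a ∷ _ = ⊥-elim (<⇒≱ (subst (root t <_) eq (All.lookup a p)) (Good-root g (here refl)))

join : ℕ → Tree × Tree × List Tree → List Tree
join i (x , y , R) = node i x y ∷ R

succs : ℕ → List Tree → List (List Tree)
succs i F = (leaf i ∷ F) ∷ map (join i) (pairs F)

build : ℕ → List Tree → List Tree
build zero    []          = []
build zero    (t ∷ [])    = t ∷ []
build zero    (_ ∷ _ ∷ _) = []
build (suc i) F           = concatMap (build i) (succs (suc i) F)

-- The new label is below all present ones, so the front is its place; `pairs` respects list order,
-- so the left child gets the smaller root.
succs-Good : ∀ {s d F F′} → Good (suc s) d F → F′ ∈ succs (suc s) F → Good s (suc d) F′
succs-Good {s} g (here refl) =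
  good (All.tabulate (Good-root g) ∷ sorted g) (_ ∷ incr g) (prep (suc s) (labs g))
succs-Good {s} g (there p) with ∈-map⁻ _ p
... | (x , y , R) , q , refl with pairs-↭ q | pairs-AllPairs (sorted g) q
... | perm | x≺y , sR with All-resp-↭ (↭-sym perm) (incr g)
... | ix ∷ iy ∷ iR = good
  (All.tabulate (λ p → Good-root g (∈-resp-↭ perm (there (there p)))) ∷ sR)
  (increasing-node⁺ {x = x} {y = y} (Good-root g (∈-resp-↭ perm (here refl)))
    (Good-root g (∈-resp-↭ perm (there (here refl)))) x≺y ix iy ∷ iR)
  (prep (suc s) (↭-trans (↭-reflexive (++-assoc (labels x) (labels y) (labelsF R))) (↭-trans (labelsF-↭ perm) (labs g))))

build-Good : ∀ s {d F t} → Good s d F → t ∈ build s F → Good 0 (s + d) (t ∷ [])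
build-Good zero    {F = _ ∷ []} g (here refl) = g
build-Good (suc s) {d} {F} {t} g p with find (∈-concatMap⁻ (build s) {xs = succs (suc s) F} p)
... | F′ , F′∈ , t∈ = subst (λ n → Good 0 n (t ∷ [])) (+-suc s d) (build-Good s (succs-Good g F′∈) t∈)

-- Undoing a step: this recovers the forest from its successor, so that no tree is built twice.
insert : Tree → List Tree → List Tree
insert x []      = x ∷ []
insert x (y ∷ R) with root x <? root y
... | yes _ = x ∷ y ∷ R
... | no  _ = y ∷ insert x R

unstep : List Tree → List Tree
unstep []               = []
unstep (leaf _ ∷ F)     = F
unstep (node _ x y ∷ F) = insert x (insert y F)

insert-head : ∀ {x F} → All (x ≺_) F → insert x F ≡ x ∷ F
insert-head []            = refl
insert-head {x} {y ∷ F} (a ∷ _) with root x <? root y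
... | yes _ = refl
... | no ¬a = ⊥-elim (¬a a)

insert-tail : ∀ {x y} F → y ≺ x → insert x (y ∷ F) ≡ y ∷ insert x F
insert-tail {x} {y} F y≺x with root x <? root y
... | yes x≺y = ⊥-elim (<-asym x≺y y≺x)
... | no _    = refl

insert-select : ∀ {F x R} → AllPairs _≺_ F → (x , R) ∈ select F → insert x R ≡ F
insert-select (a ∷ s) (here refl) = insert-head a
insert-select (a ∷ s) (there p) with ∈-map⁻ _ p
... | (x , R) , q , refl = trans (insert-tail R (All.head (All-resp-↭ (↭-sym (select-↭ q)) a)))
  (cong (_ ∷_) (insert-select s q))

insert-pairs : ∀ {F x y R} → AllPairs _≺_ F → (x , y , R) ∈ pairs F → insert x (insert y R) ≡ F
insert-pairs {z ∷ F} (a ∷ s) p with ∈-++⁻ (map (z ,_) (select F)) p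
... | inj₁ q with ∈-map⁻ _ q
...   | (y , R) , r , refl = trans (cong (insert z) (insert-select s r)) (insert-head a)
insert-pairs {z ∷ F} (a ∷ s) p | inj₂ q with ∈-map⁻ _ q
...   | (x , y , R) , r , refl with All-resp-↭ (↭-sym (pairs-↭ r)) a
...     | z≺x ∷ z≺y ∷ _ = trans (cong (insert x) (insert-tail R z≺y))
  (trans (insert-tail (insert y R) z≺x) (cong (z ∷_) (insert-pairs s r)))

unstep-succs : ∀ {i F F′} → AllPairs _≺_ F → F′ ∈ succs i F → unstep F′ ≡ F
unstep-succs s (here refl) = refl
unstep-succs s (there p) with ∈-map⁻ _ p
... | _ , q , refl = insert-pairs s q

unsteps : ℕ → List Tree → List Tree
unsteps zero    F = F
unsteps (suc i) F = unstep (unsteps i F)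

unsteps-build : ∀ s {d F t} → Good s d F → t ∈ build s F → unsteps s (t ∷ []) ≡ F
unsteps-build zero    {F = _ ∷ []} g (here refl) = refl
unsteps-build (suc s) {F = F} g p with find (∈-concatMap⁻ (build s) {xs = succs (suc s) F} p)
... | F′ , F′∈ , t∈ = trans (cong unstep (unsteps-build s (succs-Good g F′∈) t∈)) (unstep-succs (sorted g) F′∈)

sorted-Unique : ∀ {F} → AllPairs _≺_ F → Unique F
sorted-Unique []      = []
sorted-Unique (a ∷ s) = All.map (λ { x≺y refl → <-irrefl refl x≺y }) a ∷ sorted-Unique s

succs-Unique : ∀ i {F} → AllPairs _≺_ F → Unique (succs i F)
succs-Unique i {F} s = All.tabulate distinct ∷
  Uniq.map⁺ (λ { {_ , _ , _} {_ , _ , _} refl → refl }) (pairs-Unique (sorted-Unique s))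
  where
  distinct : ∀ {F′} → F′ ∈ map (join i) (pairs F) → leaf i ∷ F ≢ F′
  distinct p eq with ∈-map⁻ _ p
  distinct p () | _ , _ , refl

build-Unique : ∀ s {d F} → Good s d F → Unique (build s F)
build-Unique zero    {F = []}        g = []
build-Unique zero    {F = _ ∷ []}    g = [] ∷ []
build-Unique zero    {F = _ ∷ _ ∷ _} g = []
build-Unique (suc s) {F = F}         g = concatMap-Unique (λ t → unsteps s (t ∷ []))
  (succs-Unique (suc s) (sorted g))
  (λ F′∈ → build-Unique s (succs-Good g F′∈))
  (λ F′∈ t∈ → unsteps-build s (succs-Good g F′∈) t∈)

insert-↭ : ∀ x F → insert x F ↭ x ∷ F
insert-↭ x []      = ↭-refl
insert-↭ x (y ∷ F) with root x <? root y
... | yes _ = ↭-refl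
... | no  _ = ↭-trans (prep y (insert-↭ x F)) (swap y x ↭-refl)

insert-sorted : ∀ {x F} → AllPairs _≺_ F → All (λ y → root x ≢ root y) F → AllPairs _≺_ (insert x F)
insert-sorted [] [] = [] ∷ []
insert-sorted {x} {y ∷ F} (a ∷ s) (x≢y ∷ x≢) with root x <? root y
... | yes x≺y = (x≺y ∷ All.map (<-trans x≺y) a) ∷ a ∷ s
... | no  x⊀y = All-resp-↭ (↭-sym (insert-↭ x F)) (≤∧≢⇒< (≮⇒≥ x⊀y) (x≢y ∘ sym) ∷ a) ∷ insert-sorted s x≢

select-insert : ∀ x R → (x , R) ∈ select (insert x R)
select-insert x []      = here refl
select-insert x (y ∷ R) with root x <? root y
... | yes _ = here refl
... | no  _ = there (∈-map⁺ (map₂ (y ∷_)) (select-insert x R))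

pairs-insert : ∀ x y R → x ≺ y → (x , y , R) ∈ pairs (insert x (insert y R))
pairs-insert x y [] x≺y rewrite insert-head {x} {y ∷ []} (x≺y ∷ []) = here refl
pairs-insert x y (z ∷ R) x≺y with root y <? root z
... | yes _ with root x <? root y
...   | yes _   = here refl
...   | no x⊀y  = ⊥-elim (x⊀y x≺y)
pairs-insert x y (z ∷ R) x≺y | no y⊀z with root x <? root z
...   | yes _ = ∈-++⁺ˡ (∈-map⁺ (x ,_) (there (∈-map⁺ (map₂ (z ∷_)) (select-insert y R))))
...   | no  _ = ∈-++⁺ʳ (map (z ,_) (select (insert x (insert y R))))
                  (∈-map⁺ (map₂ (map₂ (z ∷_))) (pairs-insert x y R x≺y))

-- Every nonempty good forest has a predecessor. The two released subtrees can be sorted in because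
-- disjoint label sets give distinct roots.
unstep-Good : ∀ {s d F} → Good s (suc d) F →
  Good (suc s) d (unstep F) × F ∈ succs (suc s) (unstep F)
unstep-Good {s} {d} g with Good-head g
unstep-Good (good (_ ∷ srt) (_ ∷ i) l) | leaf _ , R , refl , refl = good srt i (drop-∷ l) , here refl
unstep-Good {s} {d} (good (_ ∷ sR) (i ∷ iR) l) | node _ x y , R , refl , refl
  with increasing-node⁻ {_} {x} {y} i
... | s<x , s<y , x≺y , ix , iy = good
  (insert-sorted (insert-sorted sR y∉R) (All-resp-↭ (↭-sym (insert-↭ y R)) (<⇒≢ x≺y ∷ x∉R)))
  (All-resp-↭ (↭-sym perm) (ix ∷ iy ∷ iR))
  (↭-trans (labelsF-↭ perm) (↭-trans (↭-sym (↭-reflexive (++-assoc (labels x) (labels y) (labelsF R)))) (drop-∷ l)))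
  , there (∈-map⁺ (join _) (pairs-insert x y R x≺y))
  where
  perm : insert x (insert y R) ↭ x ∷ y ∷ R
  perm = ↭-trans (insert-↭ x (insert y R)) (prep x (insert-↭ y R))
  disj : Disjoint (labels x ++ labels y) (labelsF R)
  disj = Unique-++⇒Disjoint (labels x ++ labels y)
    (Unique-resp-↭ (↭-sym (drop-∷ l)) (range-Unique (suc s) d))
  x∉R : All (λ t → root x ≢ root t) R
  x∉R = All.tabulate (λ {t} t∈ eq → disj
    (∈-++⁺ˡ (root∈labels x) , subst (_∈ labelsF R) (sym eq) (root∈labelsF t∈)))
  y∉R : All (λ t → root y ≢ root t) R
  y∉R = All.tabulate (λ {t} t∈ eq → disj
    (∈-++⁺ʳ (labels x) (root∈labels y) , subst (_∈ labelsF R) (sym eq) (root∈labelsF t∈)))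

-- Undoing d steps leads to a forest without labels, and only the empty one has none.
build-complete : ∀ s d {F t} → Good s d F → t ∈ build s F → t ∈ build (s + d) []
build-complete s zero {[]} {t} g t∈ = subst (λ n → t ∈ build n []) (sym (+-identityʳ s)) t∈
build-complete s zero {t ∷ F} g t∈ with () ← ∈-resp-↭ (labs g) (∈-++⁺ˡ {ys = labelsF F} (root∈labels t))
build-complete s (suc d) {t = t} g t∈ = subst (λ n → t ∈ build n []) (sym (+-suc s d))
  (build-complete (suc s) d (proj₁ (unstep-Good g))
    (∈-concatMap⁺ (build s) (lose (proj₂ (unstep-Good g)) t∈)))

Good-[] : ∀ N → Good N 0 []
Good-[] N = good [] [] ↭-refl

-- Strictly ordered binary trees as good one-tree forests

occ≢0⇒∈ : ∀ k xs → occ k xs ≢ 0 → k ∈ xs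
occ≢0⇒∈ k []       o = ⊥-elim (o refl)
occ≢0⇒∈ k (x ∷ xs) o with k ≡ᵇ x in eq
... | true  = here (≡ᵇ⇒≡ k x (subst T (sym eq) _))
... | false = there (occ≢0⇒∈ k xs o)

occ-∉ : ∀ {k xs} → All (k ≢_) xs → occ k xs ≡ 0
occ-∉ []                  = refl
occ-∉ {k} {x ∷ xs} (k≢x ∷ k∉) rewrite ≢⇒≡ᵇ-false k≢x = occ-∉ k∉

occ-Unique : ∀ {k xs} → Unique xs → k ∈ xs → occ k xs ≡ 1
occ-Unique {k} (k∉ ∷ u) (here refl) rewrite ≡ᵇ-refl k = cong suc (occ-∉ k∉)
occ-Unique {k} {x ∷ xs} (x∉ ∷ u) (there p)
  rewrite ≢⇒≡ᵇ-false {k} {x} (λ k≡x → All.lookup x∉ p (sym k≡x)) = occ-Unique u p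

allB⁻ : ∀ {f xs k} → T (allB f xs) → k ∈ xs → T (f k)
allB⁻ {xs = _ ∷ _} a (here refl) = proj₁ (∧⁻ a)
allB⁻ {f} {xs = x ∷ _} a (there p) = allB⁻ (proj₂ (∧⁻ {f x} a)) p

allB⁺ : ∀ {f xs} → (∀ {k} → k ∈ xs → T (f k)) → T (allB f xs)
allB⁺ {xs = []}    h = _
allB⁺ {xs = _ ∷ _} h = ∧⁺ (h (here refl)) (allB⁺ (λ p → h (there p)))

-- A nonzero `occ` puts each of 1, ..., N among the labels, and the length N makes them all
-- (`covering-↭`).
isSOBT⇒Good : ∀ {N t} → T (isSOBT N t) → Good 0 N (t ∷ [])
isSOBT⇒Good {N} {t} p with ∧⁻ {bijLabels N t} p
... | bij , r with ∧⁻ {length (labels t) ≡ᵇ N} bij | ∧⁻ {root t ≡ᵇ 1} r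
... | len , occs | _ , i = good ([] ∷ []) (i ∷ [])
  (↭-trans (↭-reflexive (++-identityʳ (labels t)))
    (covering-↭ (range 0 N) (range-Unique 0 N) covers
      (trans (≡ᵇ⇒≡ _ _ len) (sym (length-range 0 N)))))
  where
  covers : ∀ {k} → k ∈ range 0 N → k ∈ labels t
  covers k∈ with ∈-range⁻ 0 N k∈
  ... | s≤s {n = k} _ , k<N = occ≢0⇒∈ (suc k) (labels t)
    (λ o → 1+n≢0 (trans (sym (≡ᵇ⇒≡ (occ (suc k) (labels t)) 1 (allB⁻ occs (∈-upTo⁺ k<N)))) o))

Good⇒isSOBT : ∀ {N t} → 1 ≤ N → Good 0 N (t ∷ []) → T (isSOBT N t)
Good⇒isSOBT {suc N} {t} _ g@(good _ (i ∷ []) l) with Good-head g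
... | _ , _ , refl , root≡1 = ∧⁺ {bijLabels (suc N) t}
  (∧⁺ (≡⇒≡ᵇ _ _ (trans (↭-length perm) (length-range 0 (suc N))))
    (allB⁺ (λ {k} k∈ → ≡⇒≡ᵇ (occ (suc k) (labels t)) 1 (occ-Unique (Unique-resp-↭ (↭-sym perm) (range-Unique 0 (suc N)))
      (∈-resp-↭ (↭-sym perm) (∈-range⁺ 0 (suc N) (s≤s z≤n) (∈-upTo⁻ k∈)))))))
  (∧⁺ (≡⇒≡ᵇ _ _ root≡1) i)
  where
  perm : labels t ↭ range 0 (suc N)
  perm = ↭-trans (↭-reflexive (sym (++-identityʳ (labels t)))) l

module _ (N a p : ℕ) where
  open Val N a p

  sum-concatMap : ∀ {A B : Set} (f : B → ℕ) (g : A → List B) xs →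
    sum (map f (concatMap g xs)) ≡ sum (map (λ x → sum (map f (g x))) xs)
  sum-concatMap f g []       = refl
  sum-concatMap f g (x ∷ xs) = trans (cong sum (map-++ f (g x) _))
    (trans (sum-++ (map f (g x)) _) (cong (sum (map f (g x)) +_) (sum-concatMap f g xs)))

  -- `val` follows the recursion of `build`, with `pairSum` as the sum over `pairs`; the weight is
  -- the indicator of the two statistics.
  sum-build : ∀ i F → sum (map (λ t → e t * q t) (build i F)) ≡ val i F
  sum-build zero    []          = refl
  sum-build zero    (t ∷ [])    = +-identityʳ _
  sum-build zero    (_ ∷ _ ∷ _) = refl
  sum-build (suc i) F           = begin
    sum (map f (concatMap (build i) (succs (suc i) F)))
      ≡⟨ sum-concatMap f (build i) (succs (suc i) F) ⟩
    sum (map f (build i (leaf (suc i) ∷ F))) + sum (map g (map (join (suc i)) (pairs F)))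
      ≡⟨ cong₂ _+_ (sum-build i (leaf (suc i) ∷ F)) (cong sum (sym (map-∘ (pairs F)))) ⟩
    val i (leaf (suc i) ∷ F) + sum (map (λ (x , y , R) → g (node (suc i) x y ∷ R)) (pairs F))
      ≡⟨ cong (val i (leaf (suc i) ∷ F) +_) (sum-pairs F (λ x y R → g (node (suc i) x y ∷ R))) ⟩
    val i (leaf (suc i) ∷ F) + pairSum F (λ x y R → g (node (suc i) x y ∷ R))
      ≡⟨ cong (val i (leaf (suc i) ∷ F) +_) (pairSum-cong F (λ x y R _ → sum-build i (node (suc i) x y ∷ R))) ⟩
    val i (leaf (suc i) ∷ F) + pairSum F (λ x y R → val i (node (suc i) x y ∷ R)) ∎
    where
    open ≡-Reasoning
    f : Tree → ℕ
    f t = e t * q t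
    g : List Tree → ℕ
    g F = sum (map f (build i F))

  HasStats : Tree → Set
  HasStats t = leftmost t ≡ a × parentOf N t ≡ just p

  hasStats? : ∀ t → Dec (HasStats t)
  hasStats? t = (leftmost t ≟ a) ×-dec ≡-dec _≟_ (parentOf N t) (just p)

  length-filter : ∀ ts → length (filter hasStats? ts) ≡ sum (map (λ t → e t * q t) ts)
  length-filter []       = refl
  length-filter (t ∷ ts) with ih ← length-filter ts | leftmost t ≡ᵇ a | parentOf N t
  ... | false | _       = ih
  ... | true  | nothing = ih
  ... | true  | just x with x ≡ᵇ p
  ...   | false = ih
  ...   | true  = cong suc ih

  filtered : List Tree
  filtered = filter hasStats? (build N [])

  length-filtered : length filtered ≡ val N []
  length-filtered = trans (length-filter (build N [])) (sum-build N [])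

eoc≡leftmost : ∀ t → T (increasing t) → eoc t ≡ leftmost t
eoc≡leftmost (leaf _)     i = refl
eoc≡leftmost (node l x y) i with increasing-node⁻ {l} {x} {y} i
... | _ , _ , x≺y , ix , _ rewrite Equivalence.to T-≡ (<⇒<ᵇ x≺y) = eoc≡leftmost x ix

leftmost∈labels : ∀ t → leftmost t ∈ labels t
leftmost∈labels (leaf _)     = here refl
leftmost∈labels (node _ x _) = there (∈-++⁺ˡ (leftmost∈labels x))

-- The leaf ending the chain has a sibling of larger root, so it cannot carry the largest label.
leftmost-exceeded : ∀ l x y → T (increasing (node l x y)) → ∃ λ k → k ∈ labels (node l x y) × leftmost x < k
leftmost-exceeded l x y i with increasing-node⁻ {l} {x} {y} i
leftmost-exceeded l (leaf _) y i | _ , _ , x≺y , _ , _ = root y , there (there (root∈labels y)) , x≺y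
leftmost-exceeded l (node l′ x x′) y i | _ , _ , _ , ix , _ with leftmost-exceeded l′ x x′ ix
... | k , k∈ , lt = k , there (∈-++⁺ˡ k∈) , lt

parentOf-bounds : ∀ {v p} t → T (increasing t) → parentOf v t ≡ just p → p ∈ labels t × p < v
parentOf-bounds {v} (node l x y) i eq with increasing-node⁻ {l} {x} {y} i
... | l<x , l<y , _ , ix , iy with root x ≡ᵇ v in ex | root y ≡ᵇ v in ey
... | true  | _    rewrite sym (just-injective eq) = here refl , subst (l <_) (≡ᵇ⇒≡ _ _ (subst T (sym ex) _)) l<x
... | false | true rewrite sym (just-injective eq) = here refl , subst (l <_) (≡ᵇ⇒≡ _ _ (subst T (sym ey) _)) l<y
... | false | false with parentOf v x in px
...   | just _ with parentOf-bounds x ix (trans px eq)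
...     | p∈ , p<v = there (∈-++⁺ˡ p∈) , p<v
parentOf-bounds {v} (node l x y) i eq | l<x , l<y , _ , ix , iy | false | false | nothing
  with parentOf-bounds y iy eq
... | p∈ , p<v = there (∈-++⁺ʳ (labels x) p∈) , p<v

isSOBT⇒increasing : ∀ {N t} → T (isSOBT N t) → T (increasing t)
isSOBT⇒increasing {N} {t} p with isSOBT⇒Good {N} {t} p
... | good _ (i ∷ []) _ = i

isSOBT-label : ∀ {N t k} → T (isSOBT N t) → k ∈ labels t → 1 ≤ k × k ≤ N
isSOBT-label {N} {t} p k∈ =
  ∈-range⁻ 0 N (∈-resp-↭ (labs (isSOBT⇒Good {N} {t} p)) (∈-++⁺ˡ k∈))

eoc-bounds : ∀ {N t} → 1 < N → T (isSOBT N t) → 1 ≤ eoc t × eoc t < N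
eoc-bounds {N} {leaf l} 1<N p with trans (↭-length (labs (isSOBT⇒Good {N} {leaf l} p))) (length-range 0 N)
... | refl = ⊥-elim (<-irrefl refl 1<N)
eoc-bounds {N} {t@(node l x y)} 1<N p
  rewrite eoc≡leftmost t (isSOBT⇒increasing {N} {t} p)
  with leftmost-exceeded l x y (isSOBT⇒increasing {N} {t} p)
... | k , k∈ , lt = proj₁ (isSOBT-label {N} {t} p (leftmost∈labels t)) ,
  <-≤-trans lt (proj₂ (isSOBT-label {N} {t} p k∈))

Pom⁻ : ∀ {n b} t → Pom n t ≡ just b → ∃ λ p → parentOf (2 * n + 1) t ≡ just p × 2 * n + 1 ∸ p ≡ b
Pom⁻ {n} t eq with parentOf (2 * n + 1) t
... | just p = p , refl , just-injective eq

Pom⁺ : ∀ {n p} t → parentOf (2 * n + 1) t ≡ just p → Pom n t ≡ just (2 * n + 1 ∸ p)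
Pom⁺ {n} t eq rewrite eq = refl

Pom-bounds : ∀ {n t b} → T (isSOBT (2 * n + 1) t) → Pom n t ≡ just b → 1 ≤ b × b < 2 * n + 1
Pom-bounds {n} {t} s eq with Pom⁻ {n} t eq
... | p , par , refl with parentOf-bounds t (isSOBT⇒increasing {2 * n + 1} {t} s) par
... | p∈ , p<N = m<n⇒0<n∸m p<N , ∸-monoʳ-< (proj₁ (isSOBT-label {2 * n + 1} {t} s p∈)) (<⇒≤ p<N)

-- The bound on b makes truncated subtraction an involution here, so that p = N - b gives back Pom =
-- b.
TreesEP-Enumerates : ∀ n {a b} → b < 2 * n + 1 →
  Enumerates (λ t → T (isSOBT (2 * n + 1) t) × Eoc t ≡ a × Pom n t ≡ just b) (filtered (2 * n + 1) a (2 * n + 1 ∸ b))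
TreesEP-Enumerates n {a} {b} b<N = record
  { irrelevant = λ (s , e , p) (s′ , e′ , p′) →
      cong₂ _,_ (T-irrelevant s s′)
        (cong₂ _,_ (≡-irrelevant e e′) (Decidable⇒UIP.≡-irrelevant (≡-dec _≟_) p p′))
  ; unique   = Uniq.filter⁺ (hasStats? N a (N ∸ b)) (build-Unique N (Good-[] N))
  ; complete = complete
  ; sound    = sound
  }
  where
  N : ℕ
  N = 2 * n + 1
  complete : ∀ {t} → T (isSOBT N t) × Eoc t ≡ a × Pom n t ≡ just b → t ∈ filtered N a (N ∸ b)
  complete {t} (s , refl , eq) with Pom⁻ {n} t eq
  ... | p , par , refl = ∈-filter⁺ (hasStats? N a (N ∸ b))
    (build-complete 0 N (isSOBT⇒Good {N} {t} s) (here refl))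
    ( sym (eoc≡leftmost t i)
    , trans par (cong just (sym (m∸[m∸n]≡n (<⇒≤ (proj₂ (parentOf-bounds t i par)))))) )
    where
    i : T (increasing t)
    i = isSOBT⇒increasing {N} {t} s
  sound : ∀ {t} → t ∈ filtered N a (N ∸ b) → T (isSOBT N t) × Eoc t ≡ a × Pom n t ≡ just b
  sound {t} t∈ with ∈-filter⁻ (hasStats? N a (N ∸ b)) {xs = build N []} t∈
  ... | t∈build , lm , par = s , trans (eoc≡leftmost t (isSOBT⇒increasing {N} {t} s)) lm ,
      trans (Pom⁺ {n} t par) (cong just (m∸[m∸n]≡n (<⇒≤ b<N)))
    where
    s : T (isSOBT N t)
    s = Good⇒isSOBT {N} {t} (m≤n+m 1 (2 * n))
      (subst (λ m → Good 0 m (t ∷ [])) (+-identityʳ N) (build-Good N (Good-[] N) t∈build))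

InRange : ℕ → ℕ → Set
InRange N k = 1 ≤ k × k < N

theorem6p2 : (n : ℕ) → 1 ≤ n → (a b : ℕ) → TreesEP n a b ↔ TreesEP n b a
theorem6p2 n 1≤n a b with (1 ≤? a ×-dec a <? 2 * n + 1) ×-dec (1 ≤? b ×-dec b <? 2 * n + 1)
... | yes ((1≤a , a<N) , (1≤b , b<N)) =
  Enumerates-↔ (TreesEP-Enumerates n b<N) (TreesEP-Enumerates n a<N)
    (begin
      length (filtered N a (N ∸ b)) ≡⟨ length-filtered N a (N ∸ b) ⟩
      Val.val N a (N ∸ b) N []      ≡⟨ val-sym 1≤a a<N 1≤b b<N ⟩
      Val.val N b (N ∸ a) N []      ≡⟨ length-filtered N b (N ∸ a) ⟨
      length (filtered N b (N ∸ a)) ∎)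
  where
  open ≡-Reasoning
  N : ℕ
  N = 2 * n + 1
-- Both statistics of a tree on N > 1 vertices lie between 1 and N - 1, so for other a or b both
-- sides are empty.
... | no out = mk↔ₛ′ (λ t → ⊥-elim (out (ranges t))) (λ t → ⊥-elim (out (Prod.swap (ranges t))))
    (λ t → ⊥-elim (out (Prod.swap (ranges t)))) (λ t → ⊥-elim (out (ranges t)))
  where
  1<N : 1 < 2 * n + 1
  1<N = +-monoˡ-≤ 1 (≤-trans 1≤n (m≤m+n n _))
  ranges : ∀ {a b} → TreesEP n a b → InRange (2 * n + 1) a × InRange (2 * n + 1) b
  ranges (t , s , refl , eq) = eoc-bounds {2 * n + 1} {t} 1<N s , Pom-bounds {n} {t} s eq
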